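{- Let $n$ be an odd positive integer and let $(a_0,a_1,\ldots,a_{n-1})\in\mathbb{F}_2^n$. There exists a normal element of $\mathbb{F}_{2^n}$ over $\mathbb{F}_2$ whose corresponding vector is $(a_0,a_1,\ldots,a_{n-1})$ if and only if the polynomial $f_a(x)=\sum_{0\leq i\leq n-1}a_ix^i\in\mathbb{F}_2[x]$ is symmetric and $\gcd(f_a(x),x^n-1)=1$.
   Context: An element $\alpha\in\mathbb{F}_{2^n}$ is a normal element of $\mathbb{F}_{2^n}$ over $\mathbb{F}_2$ if $\{\alpha,\alpha^2,\alpha^{2^2},\ldots,\alpha^{2^{n-1}}\}$ is a basis of $\mathbb{F}_{2^n}$ over $\mathbb{F}_2$. The trace function is $\mathrm{Tr}_{2^n|2}(x)=\sum_{i=0}^{n-1}x^{2^i}$. The corresponding vector of $\alpha\in\mathbb{F}_{2^n}$ is $(a_0,\ldots,a_{n-1})\in\mathbb{F}_2^n$ with $a_i=\mathrm{Tr}_{2^n|2}(\alpha\cdot\alpha^{2^i})$ for $0\leq i\leq n-1$. A polynomial $a_0+a_1x+\cdots+a_{n-1}x^{n-1}$ is symmetric if $a_i=a_{n-i}$ for all $1\leq i\leq n-1$. -}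

module Defs where

open import Algebra.Bundles using (CommutativeRing)
open import Algebra.Bundles.Raw using (RawMagma; RawRing)
import Algebra.Definitions as AlgebraDefinitions
import Algebra.Definitions.RawMagma as MagmaDefinitions
import Algebra.Definitions.RawSemiring as SemiringDefinitions
open import Data.Bool.Base using (Bool; true; false)
open import Data.Bool.Properties using (xor-∧-commutativeRing)
open import Data.Fin.Base using (Fin; toℕ)
open import Data.List.Base using (List; []; _∷_; map; tabulate)
open import Data.Nat.Base as ℕ using (ℕ; zero; suc; _≤_; _<_; _∸_)
open import Data.Product.Base using (_×_; ∃)
open import Data.Vec.Functional using (Vector)
open import Function.Bundles using (Inverse)
open import Level using (Level; _⊔_)
open import Relation.Binary.PropositionalEquality using (_≡_; setoid)

private
  variable
    c ℓ : Level

-- The field of two elements: false is 0, true is 1, addition is xor and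
-- multiplication is ∧.

𝔽₂ : CommutativeRing _ _
𝔽₂ = xor-∧-commutativeRing

record IsGCD (M : RawMagma c ℓ) (x y d : RawMagma.Carrier M) : Set (c ⊔ ℓ) where
  open MagmaDefinitions M using (_∣_)
  field
    d∣x      : d ∣ x
    d∣y      : d ∣ y
    greatest : ∀ {e} → e ∣ x → e ∣ y → e ∣ d

-- A polynomial is its list of coefficients, lowest degree first. Trailing
-- zeros are allowed, so equality is equality of all coefficients.

module Polynomial (R : RawRing c ℓ) where
  private
    module R = RawRing R

  Poly : Set c
  Poly = List R.Carrier

  coeff : Poly → ℕ → R.Carrier
  coeff []      _       = R.0#
  coeff (a ∷ _) zero    = a
  coeff (_ ∷ p) (suc i) = coeff p i

  infix 4 _≈ₚ_
  record _≈ₚ_ (p q : Poly) : Set ℓ where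
    constructor mk≈ₚ
    field
      coeff-≈ : ∀ i → coeff p i R.≈ coeff q i

  infixl 6 _+ₚ_
  _+ₚ_ : Poly → Poly → Poly
  []      +ₚ q       = q
  (a ∷ p) +ₚ []      = a ∷ p
  (a ∷ p) +ₚ (b ∷ q) = (a R.+ b) ∷ (p +ₚ q)

  infixl 7 _*ₚ_
  _*ₚ_ : Poly → Poly → Poly
  []      *ₚ q = []
  (a ∷ p) *ₚ q = map (a R.*_) q +ₚ (R.0# ∷ (p *ₚ q))

  poly-rawRing : RawRing c ℓ
  poly-rawRing = record
    { Carrier = Poly
    ; _≈_     = _≈ₚ_
    ; _+_     = _+ₚ_
    ; _*_     = _*ₚ_
    ; -_      = map R.-_
    ; 0#      = []
    ; 1#      = R.1# ∷ []
    }

  X : Poly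
  X = R.0# ∷ R.1# ∷ []

  Symmetric : ℕ → Poly → Set ℓ
  Symmetric n p = ∀ i → 1 ≤ i → i < n → coeff p i R.≈ coeff p (n ∸ i)

module 𝔽₂[X] where
  open Polynomial (CommutativeRing.rawRing 𝔽₂) public
  open RawRing poly-rawRing public using (*-rawMagma; 1#)
  open RawRing poly-rawRing using (rawSemiring; _+_; -_)
  open SemiringDefinitions rawSemiring using (_^_)

  fromVector : ∀ {n} → Vector Bool n → Poly
  fromVector = tabulate

  xⁿ-1 : ℕ → Poly
  xⁿ-1 n = X ^ n + (- 1#)

-- K is a field with exactly q elements, counted up to the equality of K.

record IsFieldOfOrder (K : CommutativeRing c ℓ) (q : ℕ) : Set (c ⊔ ℓ) where
  private
    module K = CommutativeRing K
  open AlgebraDefinitions K._≈_ using (Invertible)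
  field
    1≉0         : K.1# K.≉ K.0#
    invertible  : ∀ x → x K.≉ K.0# → Invertible K.1# K._*_ x
    enumeration : Inverse K.setoid (setoid (Fin q))

-- In the following, K is meant to be a field with 2 ^ n elements.

module Extension (K : CommutativeRing c ℓ) where
  open CommutativeRing K
  open SemiringDefinitions (RawRing.rawSemiring rawRing) using (_^_; sum)

  -- The embedding of 𝔽₂ as the prime field of K; it is a ring homomorphism
  -- as K has characteristic 2.

  ι : Bool → Carrier
  ι false = 0#
  ι true  = 1#

  linearCombination : ∀ {n} → Vector Bool n → Vector Carrier n → Carrier
  linearCombination b v = sum λ i → ι (b i) * v i

  record IsBasis {n} (v : Vector Carrier n) : Set (c ⊔ ℓ) where
    field
      independent : ∀ b → linearCombination b v ≈ 0# → ∀ i → b i ≡ false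
      spanning    : ∀ x → ∃ λ b → linearCombination b v ≈ x

  conjugates : ∀ n → Carrier → Vector Carrier n
  conjugates n α i = α ^ (2 ℕ.^ toℕ i)

  IsNormal : ℕ → Carrier → Set (c ⊔ ℓ)
  IsNormal n α = IsBasis (conjugates n α)

  Tr : ℕ → Carrier → Carrier
  Tr n x = sum {n} λ i → x ^ (2 ℕ.^ toℕ i)

  -- The traces lie in the prime field, so they are compared with the entries
  -- of a vector over 𝔽₂ through ι.

  HasCorrespondingVector : ∀ {n} → Carrier → Vector Bool n → Set ℓ
  HasCorrespondingVector {n} α a =
    ∀ i → ι (a i) ≈ Tr n (α * α ^ (2 ℕ.^ toℕ i))

{-# OPTIONS --safe #-}
module Submission where

-- Let S = K[x]/(xⁿ - 1) be the group ring of ℤ/n, with the involution ⋆ given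
-- by x ↦ x⁻¹. The orbit A(α) = Σ σᵏ(α) xᵏ of α under Frobenius is a unit of S
-- iff α is normal, and A(α) A(α)⋆ = f_a where a is the corresponding vector.
-- Hence f_a is a symmetric unit, i.e. symmetric and coprime to xⁿ - 1. As n is
-- odd, some power s ↦ s^(2ʲ) is the identity of S. It follows that
--   * every principal ideal of S is generated by an idempotent, whence finitely
--     many orbits generate an ideal generated by one orbit; as no nonzero
--     element of S kills all orbits, some orbit is a unit;
--   * a symmetric unit with coefficients in 𝔽₂ has a square root s of the same
--     kind, and s² = s s⋆, so s A(β) is the orbit looked for when s² is f_a
--     divided by A(β) A(β)⋆.

open import Defs
open import Algebra.Bundles using (AbelianGroup; CommutativeMonoid; CommutativeRing)
open import Algebra.Core using (Op₁; Op₂)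
import Algebra.Definitions.RawMagma as MagmaDefinitions
import Algebra.Properties.AbelianGroup as AbelianGroupProperties
import Algebra.Properties.CommutativeMonoid.Sum as MonoidSum
import Algebra.Properties.CommutativeSemiring.Exp as Exp
import Algebra.Properties.Ring as RingProperties
import Algebra.Properties.Semiring.Mult as Mult
import Algebra.Properties.Semiring.Sum as SemiringSum
import Algebra.Solver.Ring.NaturalCoefficients.Default as Solver
open import Algebra.Structures using (IsAbelianGroup)
open import Data.Bool.Base using (Bool; true; false; if_then_else_; _xor_; _∧_)
open import Data.Empty using (⊥-elim)
open import Data.Fin.Base using (Fin; zero; suc; toℕ; fromℕ; fromℕ<; inject₁; inject≤)
open import Data.Fin.Permutation using (permutation)
open import Data.Fin.Properties as Fin
  using (inject≤-injective; pigeonhole; toℕ-fromℕ; toℕ-fromℕ<; toℕ-inject₁; toℕ-injective; toℕ<n)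
open import Data.Fin.Relation.Unary.Top using (view; ‵fromℕ; ‵inject₁)
open import Data.List.Base using (List; []; _∷_; map; length)
open import Data.Nat.Base as ℕ using (ℕ; zero; suc; _∸_; _≤_; _<_; _/_; _%_; s≤s; s≤s⁻¹)
open import Data.Nat.DivMod using (%-distribˡ-+; m%n<n; m<n⇒m%n≡m; m≡m%n+[m/n]*n; n%n≡0)
open import Data.Nat.Divisibility using (_∣_; divides)
import Data.Nat.Properties as ℕ
open import Data.Product.Base using (_×_; _,_; ∃; ∃₂; proj₁; proj₂)
open import Data.Sum.Base using (_⊎_; inj₁; inj₂)
open import Data.Vec.Functional as Vector using (Vector; init; last)
open import Function.Base using (_∘_)
open import Function.Bundles using (Inverse; _⇔_; mk⇔)
open import Level using (Level; 0ℓ; _⊔_; Lift; lift)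
open import Relation.Binary.Bundles using (Setoid)
open import Relation.Binary.PropositionalEquality as ≡ using (_≡_; _≢_; cong; cong₂)
import Relation.Binary.Reasoning.Setoid as SetoidReasoning
open import Relation.Binary.Structures using (IsEquivalence)
open import Relation.Nullary.Decidable using (Dec; yes; no; does)
open import Relation.Nullary.Negation using (¬_)

private
  variable
    c ℓ : Level

-- Inverses and square roots in S are powers: with s^(p+2) = s throughout S and p + 2 = 2^(h+1), the
-- inverse of a unit is its p-th power and a square root of any element is its 2^h-th power.
-- Symmetry and having coefficients in the prime field are fixed-point conditions of ring
-- endomorphisms, so inverses and square roots inherit them without further work.
--
-- The period exists because squaring in S is additive, squares coefficients and sends x to x².
-- Coefficients return after n steps, and so does x after some number of steps, since 2 is
-- invertible modulo an odd n.
--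
-- Orbits are the solutions of x τ(s) = s, where τ squares each coefficient. A quotient of
-- solutions, or s s⋆ for a solution s, is fixed by τ because the factors x cancel. Solutions form a
-- module over the τ-fixed elements, which is why the generator of the ideal of all orbits is again
-- an orbit.
--
-- That only 0 kills all orbits is the independence of the powers of Frobenius: a nonzero polynomial
-- of degree at most 2^(n-1) cannot vanish at 2^n points.

CharacteristicTwo : CommutativeRing c ℓ → Set ℓ
CharacteristicTwo R = 1# + 1# ≈ 0#
  where open CommutativeRing R

-- Polynomials form a commutative ring.

module PolynomialRing (R : CommutativeRing c ℓ) where
  private
    module R = CommutativeRing R
    open R using (_≈_; _+_; _*_; -_; 0#; 1#)
    open Polynomial R.rawRing
    open _≈ₚ_
    open RingProperties R.ring using (-0#≈0#)

  coeff-+ : ∀ p q i → coeff (p +ₚ q) i ≈ coeff p i + coeff q i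
  coeff-+ []      q       i       = R.sym (R.+-identityˡ _)
  coeff-+ (a ∷ p) []      i       = R.sym (R.+-identityʳ _)
  coeff-+ (a ∷ p) (b ∷ q) zero    = R.refl
  coeff-+ (a ∷ p) (b ∷ q) (suc i) = coeff-+ p q i

  coeff-map : ∀ {f} → f 0# ≈ 0# → ∀ p i → coeff (map f p) i ≈ f (coeff p i)
  coeff-map f0≈0 []      i       = R.sym f0≈0
  coeff-map f0≈0 (a ∷ p) zero    = R.refl
  coeff-map f0≈0 (a ∷ p) (suc i) = coeff-map f0≈0 p i

  coeff-scale : ∀ a p i → coeff (map (a *_) p) i ≈ a * coeff p i
  coeff-scale a = coeff-map (R.zeroʳ a)

  ≈ₚ-isEquivalence : IsEquivalence _≈ₚ_
  ≈ₚ-isEquivalence = record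
    { refl  = mk≈ₚ λ _ → R.refl
    ; sym   = λ p≈q → mk≈ₚ λ i → R.sym (coeff-≈ p≈q i)
    ; trans = λ p≈q q≈r → mk≈ₚ λ i → R.trans (coeff-≈ p≈q i) (coeff-≈ q≈r i)
    }

  private
    module E = IsEquivalence ≈ₚ-isEquivalence

    setoidₚ : Setoid _ _
    setoidₚ = record { isEquivalence = ≈ₚ-isEquivalence }

    open SetoidReasoning setoidₚ

  ∷-cong : ∀ {a b p q} → a ≈ b → p ≈ₚ q → a ∷ p ≈ₚ b ∷ q
  coeff-≈ (∷-cong a≈b p≈q) zero    = a≈b
  coeff-≈ (∷-cong a≈b p≈q) (suc i) = coeff-≈ p≈q i

  0∷≈[] : ∀ {p} → p ≈ₚ [] → 0# ∷ p ≈ₚ []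
  coeff-≈ (0∷≈[] p≈0) zero    = R.refl
  coeff-≈ (0∷≈[] p≈0) (suc i) = coeff-≈ p≈0 i

  +ₚ-cong : ∀ {p q r s} → p ≈ₚ q → r ≈ₚ s → p +ₚ r ≈ₚ q +ₚ s
  coeff-≈ (+ₚ-cong {p} {q} {r} {s} p≈q r≈s) i = R.trans (coeff-+ p r i)
    (R.trans (R.+-cong (coeff-≈ p≈q i) (coeff-≈ r≈s i)) (R.sym (coeff-+ q s i)))

  +ₚ-comm : ∀ p q → p +ₚ q ≈ₚ q +ₚ p
  coeff-≈ (+ₚ-comm p q) i =
    R.trans (coeff-+ p q i) (R.trans (R.+-comm _ _) (R.sym (coeff-+ q p i)))

  +ₚ-assoc : ∀ p q r → (p +ₚ q) +ₚ r ≈ₚ p +ₚ (q +ₚ r)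
  coeff-≈ (+ₚ-assoc p q r) i = R.trans (coeff-+ (p +ₚ q) r i)
    (R.trans (R.+-congʳ (coeff-+ p q i))
    (R.trans (R.+-assoc _ _ _)
    (R.sym (R.trans (coeff-+ p (q +ₚ r) i) (R.+-congˡ (coeff-+ q r i))))))

  +ₚ-identityʳ : ∀ p → p +ₚ [] ≈ₚ p
  +ₚ-identityʳ p = +ₚ-comm p []

  -ₚ-cong : ∀ {p q} → p ≈ₚ q → map -_ p ≈ₚ map -_ q
  coeff-≈ (-ₚ-cong {p} {q} p≈q) i = R.trans (coeff-map -0#≈0# p i)
    (R.trans (R.-‿cong (coeff-≈ p≈q i)) (R.sym (coeff-map -0#≈0# q i)))

  -ₚ-inverseˡ : ∀ p → map -_ p +ₚ p ≈ₚ []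
  coeff-≈ (-ₚ-inverseˡ p) i = R.trans (coeff-+ (map -_ p) p i)
    (R.trans (R.+-congʳ (coeff-map -0#≈0# p i)) (R.-‿inverseˡ _))

  scale-cong : ∀ {a b p q} → a ≈ b → p ≈ₚ q → map (a *_) p ≈ₚ map (b *_) q
  coeff-≈ (scale-cong {a} {b} {p} {q} a≈b p≈q) i = R.trans (coeff-scale a p i)
    (R.trans (R.*-cong a≈b (coeff-≈ p≈q i)) (R.sym (coeff-scale b q i)))

  scale-+ : ∀ a p q → map (a *_) (p +ₚ q) ≈ₚ map (a *_) p +ₚ map (a *_) q
  coeff-≈ (scale-+ a p q) i = R.trans (coeff-scale a (p +ₚ q) i)
    (R.trans (R.*-congˡ (coeff-+ p q i))
    (R.trans (R.distribˡ _ _ _)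
    (R.sym (R.trans (coeff-+ (map (a *_) p) (map (a *_) q) i)
      (R.+-cong (coeff-scale a p i) (coeff-scale a q i))))))

  scale-* : ∀ a b p → map ((a * b) *_) p ≈ₚ map (a *_) (map (b *_) p)
  coeff-≈ (scale-* a b p) i = R.trans (coeff-scale (a * b) p i)
    (R.trans (R.*-assoc _ _ _) (R.sym (R.trans (coeff-scale a (map (b *_) p) i)
      (R.*-congˡ (coeff-scale b p i)))))

  scale-0 : ∀ p → map (0# *_) p ≈ₚ []
  coeff-≈ (scale-0 p) i = R.trans (coeff-scale 0# p i) (R.zeroˡ _)

  scale-1 : ∀ p → map (1# *_) p ≈ₚ p
  coeff-≈ (scale-1 p) i = R.trans (coeff-scale 1# p i) (R.*-identityˡ _)

  scale-0∷ : ∀ a p → map (a *_) (0# ∷ p) ≈ₚ 0# ∷ map (a *_) p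
  scale-0∷ a p = ∷-cong (R.zeroʳ a) E.refl

  *ₚ-congˡ : ∀ p {q r} → q ≈ₚ r → p *ₚ q ≈ₚ p *ₚ r
  *ₚ-congˡ []      q≈r = E.refl
  *ₚ-congˡ (a ∷ p) q≈r =
    +ₚ-cong (scale-cong R.refl q≈r) (∷-cong R.refl (*ₚ-congˡ p q≈r))

  *ₚ-zeroʳ : ∀ p → p *ₚ [] ≈ₚ []
  *ₚ-zeroʳ []      = E.refl
  *ₚ-zeroʳ (a ∷ p) = 0∷≈[] (*ₚ-zeroʳ p)

  +ₚ-swap : ∀ p q r → p +ₚ (q +ₚ r) ≈ₚ q +ₚ (p +ₚ r)
  +ₚ-swap p q r = begin
    p +ₚ (q +ₚ r)  ≈⟨ +ₚ-assoc p q r ⟨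
    (p +ₚ q) +ₚ r  ≈⟨ +ₚ-cong (+ₚ-comm p q) E.refl ⟩
    (q +ₚ p) +ₚ r  ≈⟨ +ₚ-assoc q p r ⟩
    q +ₚ (p +ₚ r)  ∎

  -- Multiplication recurses on its left factor. This mirrored recursion on the right factor makes
  -- commutativity a plain induction.
  *ₚ-∷ʳ : ∀ p b q → p *ₚ (b ∷ q) ≈ₚ map (b *_) p +ₚ (0# ∷ p *ₚ q)
  *ₚ-∷ʳ []      b q = E.sym (0∷≈[] E.refl)
  *ₚ-∷ʳ (a ∷ p) b q = ∷-cong (R.+-congʳ (R.*-comm a b)) (begin
    map (a *_) q +ₚ p *ₚ (b ∷ q)
      ≈⟨ +ₚ-cong E.refl (*ₚ-∷ʳ p b q) ⟩
    map (a *_) q +ₚ (map (b *_) p +ₚ (0# ∷ p *ₚ q))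
      ≈⟨ +ₚ-swap (map (a *_) q) (map (b *_) p) (0# ∷ p *ₚ q) ⟩
    map (b *_) p +ₚ (map (a *_) q +ₚ (0# ∷ p *ₚ q)) ∎)

  *ₚ-comm : ∀ p q → p *ₚ q ≈ₚ q *ₚ p
  *ₚ-comm []      q = E.sym (*ₚ-zeroʳ q)
  *ₚ-comm (a ∷ p) q = begin
    map (a *_) q +ₚ (0# ∷ p *ₚ q)  ≈⟨ +ₚ-cong E.refl (∷-cong R.refl (*ₚ-comm p q)) ⟩
    map (a *_) q +ₚ (0# ∷ q *ₚ p)  ≈⟨ *ₚ-∷ʳ q a p ⟨
    q *ₚ (a ∷ p)                   ∎

  -- Equal polynomials may be lists of different lengths, so congruence in the left factor is no
  -- direct induction; commutativity moves that factor to the right.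
  *ₚ-cong : ∀ {p q r s} → p ≈ₚ q → r ≈ₚ s → p *ₚ r ≈ₚ q *ₚ s
  *ₚ-cong {p} {q} {r} {s} p≈q r≈s = begin
    p *ₚ r  ≈⟨ *ₚ-congˡ p r≈s ⟩
    p *ₚ s  ≈⟨ *ₚ-comm p s ⟩
    s *ₚ p  ≈⟨ *ₚ-congˡ s p≈q ⟩
    s *ₚ q  ≈⟨ *ₚ-comm s q ⟩
    q *ₚ s  ∎

  *ₚ-distribˡ : ∀ p q r → p *ₚ (q +ₚ r) ≈ₚ p *ₚ q +ₚ p *ₚ r
  *ₚ-distribˡ []      q r = E.refl
  *ₚ-distribˡ (a ∷ p) q r = begin
    map (a *_) (q +ₚ r) +ₚ (0# ∷ p *ₚ (q +ₚ r))
      ≈⟨ +ₚ-cong (scale-+ a q r) (∷-cong (R.sym (R.+-identityˡ 0#)) (*ₚ-distribˡ p q r)) ⟩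
    (aq +ₚ ar) +ₚ (pq +ₚ pr)  ≈⟨ +ₚ-assoc aq ar (pq +ₚ pr) ⟩
    aq +ₚ (ar +ₚ (pq +ₚ pr))  ≈⟨ +ₚ-cong (E.refl {aq}) (+ₚ-swap ar pq pr) ⟩
    aq +ₚ (pq +ₚ (ar +ₚ pr))  ≈⟨ +ₚ-assoc aq pq (ar +ₚ pr) ⟨
    (aq +ₚ pq) +ₚ (ar +ₚ pr)  ∎
    where
    aq = map (a *_) q
    ar = map (a *_) r
    pq = 0# ∷ p *ₚ q
    pr = 0# ∷ p *ₚ r

  *ₚ-distribʳ : ∀ r p q → (p +ₚ q) *ₚ r ≈ₚ p *ₚ r +ₚ q *ₚ r
  *ₚ-distribʳ r p q = begin
    (p +ₚ q) *ₚ r      ≈⟨ *ₚ-comm (p +ₚ q) r ⟩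
    r *ₚ (p +ₚ q)      ≈⟨ *ₚ-distribˡ r p q ⟩
    r *ₚ p +ₚ r *ₚ q   ≈⟨ +ₚ-cong (*ₚ-comm r p) (*ₚ-comm r q) ⟩
    p *ₚ r +ₚ q *ₚ r   ∎

  0∷-*ₚ : ∀ p q → (0# ∷ p) *ₚ q ≈ₚ 0# ∷ p *ₚ q
  0∷-*ₚ p q = +ₚ-cong (scale-0 q) E.refl

  scale-*ₚ : ∀ a p q → map (a *_) p *ₚ q ≈ₚ map (a *_) (p *ₚ q)
  scale-*ₚ a []      q = E.refl
  scale-*ₚ a (b ∷ p) q = begin
    map ((a * b) *_) q +ₚ (0# ∷ map (a *_) p *ₚ q)
      ≈⟨ +ₚ-cong (scale-* a b q) (∷-cong R.refl (scale-*ₚ a p q)) ⟩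
    map (a *_) (map (b *_) q) +ₚ (0# ∷ map (a *_) (p *ₚ q))
      ≈⟨ +ₚ-cong (E.refl {map (a *_) (map (b *_) q)}) (scale-0∷ a (p *ₚ q)) ⟨
    map (a *_) (map (b *_) q) +ₚ map (a *_) (0# ∷ p *ₚ q)
      ≈⟨ scale-+ a (map (b *_) q) (0# ∷ p *ₚ q) ⟨
    map (a *_) ((b ∷ p) *ₚ q) ∎

  *ₚ-assoc : ∀ p q r → (p *ₚ q) *ₚ r ≈ₚ p *ₚ (q *ₚ r)
  *ₚ-assoc []      q r = E.refl
  *ₚ-assoc (a ∷ p) q r = begin
    (map (a *_) q +ₚ (0# ∷ p *ₚ q)) *ₚ r
      ≈⟨ *ₚ-distribʳ r (map (a *_) q) (0# ∷ p *ₚ q) ⟩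
    map (a *_) q *ₚ r +ₚ (0# ∷ p *ₚ q) *ₚ r
      ≈⟨ +ₚ-cong (scale-*ₚ a q r) (0∷-*ₚ (p *ₚ q) r) ⟩
    map (a *_) (q *ₚ r) +ₚ (0# ∷ (p *ₚ q) *ₚ r)
      ≈⟨ +ₚ-cong (E.refl {map (a *_) (q *ₚ r)}) (∷-cong R.refl (*ₚ-assoc p q r)) ⟩
    map (a *_) (q *ₚ r) +ₚ (0# ∷ p *ₚ (q *ₚ r)) ∎

  *ₚ-identityˡ : ∀ p → (1# ∷ []) *ₚ p ≈ₚ p
  *ₚ-identityˡ p = begin
    map (1# *_) p +ₚ (0# ∷ [])  ≈⟨ +ₚ-cong (scale-1 p) (0∷≈[] E.refl) ⟩
    p +ₚ []                     ≈⟨ +ₚ-identityʳ p ⟩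
    p                           ∎

  poly-commutativeRing : CommutativeRing c ℓ
  poly-commutativeRing = record
    { isCommutativeRing = record
      { isRing = record
        { +-isAbelianGroup = record
          { isGroup = record
            { isMonoid = record
              { isSemigroup = record
                { isMagma = record
                  { isEquivalence = ≈ₚ-isEquivalence
                  ; ∙-cong        = +ₚ-cong
                  }
                ; assoc = +ₚ-assoc
                }
              ; identity = (λ _ → E.refl) , +ₚ-identityʳ
              }
            ; inverse = -ₚ-inverseˡ ,
                λ p → E.trans (+ₚ-comm p (map -_ p)) (-ₚ-inverseˡ p)
            ; ⁻¹-cong = -ₚ-cong
            }
          ; comm = +ₚ-comm
          }
        ; *-cong     = *ₚ-cong
        ; *-assoc    = *ₚ-assoc
        ; *-identity = *ₚ-identityˡ ,
            λ p → E.trans (*ₚ-comm p (1# ∷ [])) (*ₚ-identityˡ p)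
        ; distrib    = *ₚ-distribˡ , *ₚ-distribʳ
        }
      ; *-comm = *ₚ-comm
      }
    }

-- Sums over finite index sets.

module _ (M : CommutativeMonoid c ℓ) where
  open CommutativeMonoid M
  open MonoidSum M using (sum; sum-cong-≋; sum-replicate-zero; sum-permute)

  sum-single : ∀ {n} (f : Vector Carrier n) i → (∀ j → j ≢ i → f j ≈ ε) → sum f ≈ f i
  sum-single {suc n} f zero    f≈ε = trans
    (∙-congˡ (trans (sum-cong-≋ λ j → f≈ε (suc j) λ ()) (sum-replicate-zero n)))
    (identityʳ _)
  sum-single {suc n} f (suc i) f≈ε = trans
    (∙-cong (f≈ε zero λ ())
      (sum-single (f ∘ suc) i λ j j≢i → f≈ε (suc j) λ { ≡.refl → j≢i ≡.refl }))
    (identityˡ _)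

  sum-reindex : ∀ {m n} (f : Vector Carrier n) (to : Fin m → Fin n) (from : Fin n → Fin m) →
    (∀ i → to (from i) ≡ i) → (∀ i → from (to i) ≡ i) → sum f ≈ sum (f ∘ to)
  sum-reindex f to from to∘from from∘to = sum-permute f (permutation to from to∘from from∘to)

-- The additive group of residues modulo `suc m`.

module Cyclic (m : ℕ) where
  private
    N = suc m

  [_] : ℕ → Fin N
  [ a ] = fromℕ< (m%n<n a N)

  infixl 6 _⊕_
  _⊕_ : Op₂ (Fin N)
  i ⊕ j = [ toℕ i ℕ.+ toℕ j ]

  ⊖_ : Op₁ (Fin N)
  ⊖ i = [ N ∸ toℕ i ]

  toℕ-[] : ∀ a → toℕ [ a ] ≡ a % N
  toℕ-[] a = toℕ-fromℕ< (m%n<n a N)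

  []-cong-% : ∀ a b → a % N ≡ b % N → [ a ] ≡ [ b ]
  []-cong-% a b eq =
    toℕ-injective (≡.trans (toℕ-[] a) (≡.trans eq (≡.sym (toℕ-[] b))))

  []-toℕ : ∀ i → [ toℕ i ] ≡ i
  []-toℕ i = toℕ-injective (≡.trans (toℕ-[] (toℕ i)) (m<n⇒m%n≡m (toℕ<n i)))

  -- Associativity and inverses are inherited from ℕ through this compatibility of reduction with
  -- addition.
  []-+ : ∀ a b → [ a ] ⊕ [ b ] ≡ [ a ℕ.+ b ]
  []-+ a b = []-cong-% (toℕ [ a ] ℕ.+ toℕ [ b ]) (a ℕ.+ b)
    (≡.trans (cong (_% N) (cong₂ ℕ._+_ (toℕ-[] a) (toℕ-[] b)))
      (≡.sym (%-distribˡ-+ a b N)))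

  ⊕-comm : ∀ i j → i ⊕ j ≡ j ⊕ i
  ⊕-comm i j = cong [_] (ℕ.+-comm (toℕ i) (toℕ j))

  ⊕-assoc : ∀ i j k → (i ⊕ j) ⊕ k ≡ i ⊕ (j ⊕ k)
  ⊕-assoc i j k = begin
    (i ⊕ j) ⊕ k                    ≡⟨ cong ((i ⊕ j) ⊕_) ([]-toℕ k) ⟨
    (i ⊕ j) ⊕ [ toℕ k ]            ≡⟨ []-+ (toℕ i ℕ.+ toℕ j) (toℕ k) ⟩
    [ toℕ i ℕ.+ toℕ j ℕ.+ toℕ k ]  ≡⟨ cong [_] (ℕ.+-assoc (toℕ i) (toℕ j) (toℕ k)) ⟩
    [ toℕ i ℕ.+ (toℕ j ℕ.+ toℕ k) ] ≡⟨ []-+ (toℕ i) (toℕ j ℕ.+ toℕ k) ⟨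
    [ toℕ i ] ⊕ (j ⊕ k)            ≡⟨ cong (_⊕ (j ⊕ k)) ([]-toℕ i) ⟩
    i ⊕ (j ⊕ k)                    ∎
    where open ≡.≡-Reasoning

  ⊕-identityˡ : ∀ i → zero ⊕ i ≡ i
  ⊕-identityˡ = []-toℕ

  ⊖-inverseʳ : ∀ i → i ⊕ (⊖ i) ≡ zero
  ⊖-inverseʳ i = begin
    i ⊕ [ N ∸ toℕ i ]          ≡⟨ cong (_⊕ [ N ∸ toℕ i ]) ([]-toℕ i) ⟨
    [ toℕ i ] ⊕ [ N ∸ toℕ i ]  ≡⟨ []-+ (toℕ i) (N ∸ toℕ i) ⟩
    [ toℕ i ℕ.+ (N ∸ toℕ i) ]  ≡⟨ cong [_] (ℕ.m+[n∸m]≡n (ℕ.<⇒≤ (toℕ<n i))) ⟩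
    [ N ]                      ≡⟨ []-cong-% N 0 (n%n≡0 N) ⟩
    zero                       ∎
    where open ≡.≡-Reasoning

  -- Index 0 is excluded because N ∸ 0 = N reduces to 0. The remaining indices are exactly those
  -- constrained by `Symmetric`.
  toℕ-⊖ : ∀ i → i ≢ zero → toℕ (⊖ i) ≡ N ∸ toℕ i
  toℕ-⊖ zero    i≢0 = ⊥-elim (i≢0 ≡.refl)
  toℕ-⊖ (suc i) _   = ≡.trans (toℕ-[] (N ∸ suc (toℕ i)))
    (m<n⇒m%n≡m (ℕ.s≤s (ℕ.m∸n≤m m (toℕ i))))

  ⊕-isAbelianGroup : IsAbelianGroup _≡_ _⊕_ zero ⊖_
  ⊕-isAbelianGroup = record
    { isGroup = record
      { isMonoid = record
        { isSemigroup = record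
          { isMagma = record
            { isEquivalence = ≡.isEquivalence
            ; ∙-cong        = cong₂ _⊕_
            }
          ; assoc = ⊕-assoc
          }
        ; identity = ⊕-identityˡ , λ i → ≡.trans (⊕-comm i zero) (⊕-identityˡ i)
        }
      ; inverse = (λ i → ≡.trans (⊕-comm (⊖ i) i) (⊖-inverseʳ i)) , ⊖-inverseʳ
      ; ⁻¹-cong = cong ⊖_
      }
    ; comm = ⊕-comm
    }

-- The group ring of a finite abelian group, with convolution as product, and its involution.

module GroupRing (R : CommutativeRing c ℓ) {n : ℕ}
  {_⊕_ : Op₂ (Fin n)} {o : Fin n} {⊖_ : Op₁ (Fin n)}
  (isAbelianGroup : IsAbelianGroup _≡_ _⊕_ o ⊖_) where

  private
    indexGroup : AbelianGroup 0ℓ 0ℓ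
    indexGroup = record { isAbelianGroup = isAbelianGroup }

    module G where
      open AbelianGroup indexGroup public
      open AbelianGroupProperties indexGroup public

  open CommutativeRing R
  open SemiringSum semiring
  open SetoidReasoning setoid

  infixl 6 _⊝_
  _⊝_ : Op₂ (Fin n)
  i ⊝ j = i ⊕ (⊖ j)

  ⊝-⊕ : ∀ i j → (i ⊝ j) ⊕ j ≡ i
  ⊝-⊕ i j = G.//-rightDividesˡ j i

  ⊕-⊝ : ∀ i j → (i ⊕ j) ⊝ j ≡ i
  ⊕-⊝ i j = G.//-rightDividesʳ j i

  ⊝-⊝ : ∀ k i → k ⊝ (k ⊝ i) ≡ i
  ⊝-⊝ k i = ≡.trans (cong (k ⊕_) (≡.trans (≡.sym (G.⁻¹-∙-comm k (⊖ i)))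
    (cong ((⊖ k) ⊕_) (G.⁻¹-involutive i)))) (G.\\-leftDividesˡ k i)

  ⊝-swap : ∀ k i j → k ⊝ (i ⊕ j) ≡ (k ⊝ j) ⊝ i
  ⊝-swap k i j = ≡.trans (cong (k ⊕_) (≡.trans (cong ⊖_ (G.comm i j)) (≡.sym (G.⁻¹-∙-comm j i))))
    (≡.sym (G.assoc k (⊖ j) (⊖ i)))

  ∑-shift : ∀ j (f : Vector Carrier n) → sum f ≈ sum λ i → f (i ⊕ j)
  ∑-shift j f = sum-reindex +-commutativeMonoid f (_⊕ j) (_⊝ j)
    (λ i → ⊝-⊕ i j) (λ i → ⊕-⊝ i j)

  ∑-reflect : ∀ k (f : Vector Carrier n) → sum f ≈ sum λ i → f (k ⊝ i)
  ∑-reflect k f = sum-reindex +-commutativeMonoid f (k ⊝_) (k ⊝_) (⊝-⊝ k) (⊝-⊝ k)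

  ∑-⊖ : ∀ (f : Vector Carrier n) → sum f ≈ sum λ i → f (⊖ i)
  ∑-⊖ f = sum-reindex +-commutativeMonoid f ⊖_ ⊖_ G.⁻¹-involutive G.⁻¹-involutive

  infixl 7 _⊛_
  _⊛_ : Op₂ (Vector Carrier n)
  (f ⊛ g) k = sum λ i → f i * g (k ⊝ i)

  δ : Fin n → Vector Carrier n
  δ i j with i Fin.≟ j
  ... | yes _ = 1#
  ... | no  _ = 0#

  δ-≡ : ∀ {i j} → i ≡ j → δ i j ≈ 1#
  δ-≡ {i} {j} i≡j with i Fin.≟ j
  ... | yes _   = refl
  ... | no  i≢j = ⊥-elim (i≢j i≡j)

  δ-≢ : ∀ {i j} → i ≢ j → δ i j ≈ 0#
  δ-≢ {i} {j} i≢j with i Fin.≟ j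
  ... | yes i≡j = ⊥-elim (i≢j i≡j)
  ... | no  _   = refl

  ∑-δ : ∀ i (f : Vector Carrier n) → sum (λ j → δ i j * f j) ≈ f i
  ∑-δ i f = trans
    (sum-single +-commutativeMonoid (λ j → δ i j * f j) i λ j j≢i →
      trans (*-congʳ (δ-≢ (j≢i ∘ ≡.sym))) (zeroˡ _))
    (trans (*-congʳ (δ-≡ {i} ≡.refl)) (*-identityˡ _))

  ⊛-cong : ∀ {f f′ g g′} → (∀ i → f i ≈ f′ i) → (∀ i → g i ≈ g′ i) →
    ∀ k → (f ⊛ g) k ≈ (f′ ⊛ g′) k
  ⊛-cong f≈f′ g≈g′ k = sum-cong-≋ λ i → *-cong (f≈f′ i) (g≈g′ (k ⊝ i))

  δ-⊛ : ∀ i f k → (δ i ⊛ f) k ≈ f (k ⊝ i)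
  δ-⊛ i f k = ∑-δ i (λ j → f (k ⊝ j))

  ⊛-comm : ∀ f g k → (f ⊛ g) k ≈ (g ⊛ f) k
  ⊛-comm f g k = begin
    sum (λ i → f i * g (k ⊝ i))              ≈⟨ ∑-reflect k (λ i → f i * g (k ⊝ i)) ⟩
    sum (λ i → f (k ⊝ i) * g (k ⊝ (k ⊝ i)))  ≈⟨ sum-cong-≋ (λ i → trans (*-comm _ _)
                                                  (*-congʳ (reflexive (cong g (⊝-⊝ k i))))) ⟩
    sum (λ i → g i * f (k ⊝ i))              ∎

  ⊛-assoc : ∀ f g h k → ((f ⊛ g) ⊛ h) k ≈ (f ⊛ (g ⊛ h)) k
  ⊛-assoc f g h k = begin
    sum (λ i → sum (λ j → f j * g (i ⊝ j)) * h (k ⊝ i))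
      ≈⟨ sum-cong-≋ (λ i → *-distribʳ-sum (h (k ⊝ i)) (λ j → f j * g (i ⊝ j))) ⟩
    sum (λ i → sum λ j → f j * g (i ⊝ j) * h (k ⊝ i))
      ≈⟨ ∑-comm (λ i j → f j * g (i ⊝ j) * h (k ⊝ i)) ⟩
    sum (λ j → sum λ i → f j * g (i ⊝ j) * h (k ⊝ i))
      ≈⟨ sum-cong-≋ (λ j → ∑-shift j (λ i → f j * g (i ⊝ j) * h (k ⊝ i))) ⟩
    sum (λ j → sum λ i → f j * g ((i ⊕ j) ⊝ j) * h (k ⊝ (i ⊕ j)))
      ≈⟨ sum-cong-≋ (λ j → sum-cong-≋ λ i → trans
           (*-cong (*-congˡ (reflexive (cong g (⊕-⊝ i j)))) (reflexive (cong h (⊝-swap k i j))))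
           (*-assoc (f j) (g i) (h ((k ⊝ j) ⊝ i)))) ⟩
    sum (λ j → sum λ i → f j * (g i * h ((k ⊝ j) ⊝ i)))
      ≈⟨ sum-cong-≋ (λ j → *-distribˡ-sum (f j) (λ i → g i * h ((k ⊝ j) ⊝ i))) ⟨
    sum (λ j → f j * sum (λ i → g i * h ((k ⊝ j) ⊝ i))) ∎

  ⊛-identityˡ : ∀ f k → (δ o ⊛ f) k ≈ f k
  ⊛-identityˡ f k = trans (δ-⊛ o f k)
    (reflexive (cong f (≡.trans (cong (k ⊕_) G.ε⁻¹≈ε) (G.identityʳ k))))

  ⊛-distribˡ : ∀ f g h k → (f ⊛ (λ i → g i + h i)) k ≈ (f ⊛ g) k + (f ⊛ h) k
  ⊛-distribˡ f g h k = trans (sum-cong-≋ λ i → distribˡ (f i) (g (k ⊝ i)) (h (k ⊝ i)))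
    (∑-distrib-+ (λ i → f i * g (k ⊝ i)) (λ i → f i * h (k ⊝ i)))

  groupRing : CommutativeRing c ℓ
  groupRing = record
    { Carrier = Vector Carrier n
    ; _≈_ = λ f g → ∀ i → f i ≈ g i
    ; _+_ = λ f g i → f i + g i
    ; _*_ = _⊛_
    ; -_  = λ f i → - f i
    ; 0#  = λ _ → 0#
    ; 1#  = δ o
    ; isCommutativeRing = record
      { isRing = record
        { +-isAbelianGroup = record
          { isGroup = record
            { isMonoid = record
              { isSemigroup = record
                { isMagma = record
                  { isEquivalence = record
                    { refl  = λ _ → refl
                    ; sym   = λ f≈g i → sym (f≈g i)
                    ; trans = λ f≈g g≈h i → trans (f≈g i) (g≈h i)
                    }
                  ; ∙-cong = λ f≈f′ g≈g′ i → +-cong (f≈f′ i) (g≈g′ i)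
                  }
                ; assoc = λ f g h i → +-assoc (f i) (g i) (h i)
                }
              ; identity = (λ f i → +-identityˡ (f i)) , (λ f i → +-identityʳ (f i))
              }
            ; inverse = (λ f i → -‿inverseˡ (f i)) , (λ f i → -‿inverseʳ (f i))
            ; ⁻¹-cong = λ f≈g i → -‿cong (f≈g i)
            }
          ; comm = λ f g i → +-comm (f i) (g i)
          }
        ; *-cong     = ⊛-cong
        ; *-assoc    = ⊛-assoc
        ; *-identity = ⊛-identityˡ ,
            λ f k → trans (⊛-comm f (δ o) k) (⊛-identityˡ f k)
        ; distrib    = ⊛-distribˡ , λ f g h k → trans (⊛-comm (λ i → g i + h i) f k)
            (trans (⊛-distribˡ f g h k) (+-cong (⊛-comm f g k) (⊛-comm f h k)))
        }
      ; *-comm = ⊛-comm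
      }
    }

  private
    module S = CommutativeRing groupRing

  module S∑ = SemiringSum S.semiring

  infixl 9 _⋆
  _⋆ : Op₁ (Vector Carrier n)
  (f ⋆) k = f (⊖ k)

  ⋆-involutive : ∀ f → f ⋆ ⋆ S.≈ f
  ⋆-involutive f k = reflexive (cong f (G.⁻¹-involutive k))

  -- Inversion is an endomorphism of the index group because that group is abelian, so it extends to
  -- the group ring.
  ⋆-homo-⊛ : ∀ f g → (f ⊛ g) ⋆ S.≈ f ⋆ ⊛ g ⋆
  ⋆-homo-⊛ f g k = trans (∑-⊖ λ i → f i * g ((⊖ k) ⊝ i))
    (sum-cong-≋ λ i → *-congˡ (reflexive (cong g (G.⁻¹-∙-comm k (⊖ i)))))


  const : Carrier → Vector Carrier n
  const a i = a * δ o i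

  const-⊛ : ∀ a f k → (const a ⊛ f) k ≈ a * f k
  const-⊛ a f k = begin
    sum (λ i → a * δ o i * f (k ⊝ i))    ≈⟨ sum-cong-≋ (λ i → *-assoc a (δ o i) (f (k ⊝ i))) ⟩
    sum (λ i → a * (δ o i * f (k ⊝ i)))  ≈⟨ *-distribˡ-sum a (λ i → δ o i * f (k ⊝ i)) ⟨
    a * (δ o ⊛ f) k                      ≈⟨ *-congˡ (⊛-identityˡ f k) ⟩
    a * f k                              ∎

  ∑-pointwise : ∀ {m} (v : Vector (Vector Carrier n) m) k → S∑.sum v k ≈ sum λ i → v i k
  ∑-pointwise {zero}  v k = refl
  ∑-pointwise {suc m} v k = +-congˡ (∑-pointwise (v ∘ suc) k)

  monomials : ∀ f → f S.≈ S∑.sum λ i → const (f i) ⊛ δ i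
  monomials f k = sym (begin
    S∑.sum (λ i → const (f i) ⊛ δ i) k  ≈⟨ ∑-pointwise (λ i → const (f i) ⊛ δ i) k ⟩
    sum (λ i → (const (f i) ⊛ δ i) k)   ≈⟨ sum-cong-≋ (λ i → const-⊛ (f i) (δ i) k) ⟩
    sum (λ i → f i * δ i k)             ≈⟨ sum-single +-commutativeMonoid (λ i → f i * δ i k) k
                                             (λ i i≢k → trans (*-congˡ (δ-≢ i≢k)) (zeroʳ (f i))) ⟩
    f k * δ k k                         ≈⟨ *-congˡ (δ-≡ {k} ≡.refl) ⟩
    f k * 1#                            ≈⟨ *-identityʳ (f k) ⟩
    f k                                 ∎)

-- Identities in characteristic two.

module CharacteristicTwoProperties (R : CommutativeRing c ℓ)
  (1+1≈0 : CharacteristicTwo R) where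
  open CommutativeRing R hiding (zero)
  open Exp commutativeSemiring
  open SemiringSum semiring using (sum; sum-cong-≋)
  open Solver commutativeSemiring using (solve; _:+_; _:*_; _:=_)
  open SetoidReasoning setoid

  x+x≈0 : ∀ x → x + x ≈ 0#
  x+x≈0 x = begin
    x + x            ≈⟨ +-cong (*-identityʳ x) (*-identityʳ x) ⟨
    x * 1# + x * 1#  ≈⟨ distribˡ x 1# 1# ⟨
    x * (1# + 1#)    ≈⟨ *-congˡ 1+1≈0 ⟩
    x * 0#           ≈⟨ zeroʳ x ⟩
    0#               ∎

  x+[x+y]≈y : ∀ x y → x + (x + y) ≈ y
  x+[x+y]≈y x y = trans (sym (+-assoc x x y)) (trans (+-congʳ (x+x≈0 x)) (+-identityˡ y))

  x+y≈0⇒x≈y : ∀ {x y} → x + y ≈ 0# → x ≈ y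
  x+y≈0⇒x≈y {x} {y} x+y≈0 = begin
    x            ≈⟨ +-identityʳ x ⟨
    x + 0#       ≈⟨ +-congˡ x+y≈0 ⟨
    x + (x + y)  ≈⟨ x+[x+y]≈y x y ⟩
    y            ∎

  ^2^suc : ∀ x j → x ^ (2 ℕ.^ suc j) ≈ x ^ (2 ℕ.^ j) * x ^ (2 ℕ.^ j)
  ^2^suc x j = begin
    x ^ (2 ℕ.^ suc j)                ≈⟨ ^-congʳ x (cong (2 ℕ.^ j ℕ.+_) (ℕ.+-identityʳ (2 ℕ.^ j))) ⟩
    x ^ (2 ℕ.^ j ℕ.+ 2 ℕ.^ j)        ≈⟨ ^-homo-* x (2 ℕ.^ j) (2 ℕ.^ j) ⟩
    x ^ (2 ℕ.^ j) * x ^ (2 ℕ.^ j)    ∎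

  square-+ : ∀ x y → (x + y) * (x + y) ≈ x * x + y * y
  square-+ x y = begin
    (x + y) * (x + y)                ≈⟨ solve 2 (λ x y → (x :+ y) :* (x :+ y) :=
                                          (x :* y :+ x :* y) :+ (x :* x :+ y :* y)) refl x y ⟩
    x * y + x * y + (x * x + y * y)  ≈⟨ +-congʳ (x+x≈0 (x * y)) ⟩
    0# + (x * x + y * y)             ≈⟨ +-identityˡ _ ⟩
    x * x + y * y                    ∎

  ^2^-distrib-+ : ∀ x y j → (x + y) ^ (2 ℕ.^ j) ≈ x ^ (2 ℕ.^ j) + y ^ (2 ℕ.^ j)
  ^2^-distrib-+ x y zero    = trans (*-identityʳ _) (sym (+-cong (*-identityʳ x) (*-identityʳ y)))
  ^2^-distrib-+ x y (suc j) = begin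
    (x + y) ^ (2 ℕ.^ suc j)                    ≈⟨ ^2^suc (x + y) j ⟩
    (x + y) ^ (2 ℕ.^ j) * (x + y) ^ (2 ℕ.^ j)  ≈⟨ *-cong (^2^-distrib-+ x y j) (^2^-distrib-+ x y j) ⟩
    (xʲ + yʲ) * (xʲ + yʲ)                      ≈⟨ square-+ xʲ yʲ ⟩
    xʲ * xʲ + yʲ * yʲ                          ≈⟨ +-cong (^2^suc x j) (^2^suc y j) ⟨
    x ^ (2 ℕ.^ suc j) + y ^ (2 ℕ.^ suc j)      ∎
    where
    xʲ = x ^ (2 ℕ.^ j)
    yʲ = y ^ (2 ℕ.^ j)

  0^2^ : ∀ j → 0# ^ (2 ℕ.^ j) ≈ 0#
  0^2^ zero    = *-identityʳ 0#
  0^2^ (suc j) = trans (^2^suc 0# j) (trans (*-congʳ (0^2^ j)) (zeroˡ _))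

  ^2^-distrib-sum : ∀ {n} (v : Vector Carrier n) j →
    sum v ^ (2 ℕ.^ j) ≈ sum λ i → v i ^ (2 ℕ.^ j)
  ^2^-distrib-sum {zero}  v j = 0^2^ j
  ^2^-distrib-sum {suc n} v j = trans (^2^-distrib-+ (v zero) (sum (v ∘ suc)) j)
    (+-congˡ (^2^-distrib-sum (v ∘ suc) j))

  square-sum : ∀ {n} (v : Vector Carrier n) → sum v * sum v ≈ sum λ i → v i * v i
  square-sum v = trans (sym (square (sum v)))
    (trans (^2^-distrib-sum v 1) (sum-cong-≋ λ i → square (v i)))
    where
    square : ∀ x → x ^ 2 ≈ x * x
    square x = *-congˡ (*-identityʳ x)

-- Polynomial functions and their roots.

module PolynomialFunctions (R : CommutativeRing c ℓ) where
  open CommutativeRing R hiding (zero)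
  open Exp commutativeSemiring
  open SemiringSum semiring using (sum)
  open Solver commutativeSemiring using (solve; _:+_; _:*_; _:=_)
  open SetoidReasoning setoid

  -- f is a polynomial function of degree at most m whose coefficient at
  -- degree m is a. Divided differences replace coefficients: x and r are
  -- related by x ≈ r + d to avoid the subtraction x - r.
  Polynomial≤ : ℕ → Carrier → (Carrier → Carrier) → Set (c ⊔ ℓ)
  Polynomial≤ zero    a f = Lift c (∀ x → f x ≈ a)
  Polynomial≤ (suc m) a f = ∀ r → ∃ λ g → Polynomial≤ m a g ×
    (∀ x d → x ≈ r + d → f x ≈ f r + d * g x)

  respects : ∀ m {a b f g} → a ≈ b → (∀ x → f x ≈ g x) → Polynomial≤ m a f → Polynomial≤ m b g
  respects zero    a≈b f≈g (lift f≈a) =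
    lift λ x → trans (sym (f≈g x)) (trans (f≈a x) a≈b)
  respects (suc m) a≈b f≈g pf r with pf r
  ... | h , ph , eq = h , respects m a≈b (λ _ → refl) ph ,
    λ x d x≈r+d → trans (sym (f≈g x)) (trans (eq x d x≈r+d) (+-congʳ (f≈g r)))

  add : ∀ m {a b f g} → Polynomial≤ m a f → Polynomial≤ m b g →
    Polynomial≤ m (a + b) (λ x → f x + g x)
  add zero    (lift f≈a) (lift g≈b) = lift λ x → +-cong (f≈a x) (g≈b x)
  add (suc m) {f = f} {g} pf pg r with pf r | pg r
  ... | h , ph , eqf | k , pk , eqg = (λ x → h x + k x) , add m ph pk , λ x d x≈r+d → begin
    f x + g x                          ≈⟨ +-cong (eqf x d x≈r+d) (eqg x d x≈r+d) ⟩
    f r + d * h x + (g r + d * k x)    ≈⟨ solve 5 (λ f g d h k → f :+ d :* h :+ (g :+ d :* k) :=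
                                            f :+ g :+ d :* (h :+ k)) refl (f r) (g r) d (h x) (k x) ⟩
    f r + g r + d * (h x + k x)        ∎

  scale : ∀ m b {a f} → Polynomial≤ m a f → Polynomial≤ m (b * a) (λ x → b * f x)
  scale zero    b (lift f≈a) = lift λ x → *-congˡ (f≈a x)
  scale (suc m) b {f = f} pf r with pf r
  ... | h , ph , eq = (λ x → b * h x) , scale m b ph , λ x d x≈r+d → begin
    b * f x                  ≈⟨ *-congˡ (eq x d x≈r+d) ⟩
    b * (f r + d * h x)      ≈⟨ solve 4 (λ b f d h → b :* (f :+ d :* h) :=
                                  b :* f :+ d :* (b :* h)) refl b (f r) d (h x) ⟩
    b * f r + d * (b * h x)  ∎

  weaken : ∀ m {a f} → Polynomial≤ m a f → Polynomial≤ (suc m) 0# f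
  weaken zero    {f = f} (lift f≈a) r =
    (λ _ → 0#) , lift (λ _ → refl) , λ x d _ → begin
      f x           ≈⟨ trans (f≈a x) (sym (f≈a r)) ⟩
      f r           ≈⟨ +-identityʳ (f r) ⟨
      f r + 0#      ≈⟨ +-congˡ (zeroʳ d) ⟨
      f r + d * 0#  ∎
  weaken (suc m) pf r with pf r
  ... | h , ph , eq = h , weaken m ph , eq

  weaken-< : ∀ {m n a f} → m < n → Polynomial≤ m a f → Polynomial≤ n 0# f
  weaken-< {m} m<n pf = go (ℕ.≤⇒≤′ m<n)
    where
    go : ∀ {n} → suc m ℕ.≤′ n → Polynomial≤ n 0# _
    go ℕ.≤′-refl       = weaken m pf
    go (ℕ.≤′-step m<n) = weaken _ (go m<n)

  times-x : ∀ m {a f} → Polynomial≤ m a f → Polynomial≤ (suc m) a (λ x → x * f x)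
  times-x zero {f = f} pf@(lift f≈a) r = f , pf , λ x d x≈r+d → begin
    x * f x            ≈⟨ *-congʳ x≈r+d ⟩
    (r + d) * f x      ≈⟨ distribʳ (f x) r d ⟩
    r * f x + d * f x  ≈⟨ +-congʳ (*-congˡ (trans (f≈a x) (sym (f≈a r)))) ⟩
    r * f r + d * f x  ∎
  times-x (suc m) {f = f} pf r with pf r
  ... | h , ph , eq =
    -- For x = r + d this is the divided difference of x f(x). Its top coefficient comes from f
    -- alone, as h has degree one less.
    (λ x → f x + r * h x) ,
    respects (suc m) (+-identityʳ _) (λ _ → refl) (add (suc m) pf (weaken m (scale m r ph))) ,
    λ x d x≈r+d → begin
      x * f x                        ≈⟨ *-congʳ x≈r+d ⟩
      (r + d) * f x                  ≈⟨ distribʳ (f x) r d ⟩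
      r * f x + d * f x              ≈⟨ +-congʳ (*-congˡ (eq x d x≈r+d)) ⟩
      r * (f r + d * h x) + d * f x  ≈⟨ solve 5 (λ r f d h k → r :* (f :+ d :* h) :+ d :* k :=
                                          r :* f :+ d :* (k :+ r :* h)) refl r (f r) d (h x) (f x) ⟩
      r * f r + d * (f x + r * h x)  ∎

  power : ∀ m → Polynomial≤ m 1# (_^ m)
  power zero    = lift λ _ → refl
  power (suc m) = times-x m (power m)

  zeroPolynomial : ∀ m → Polynomial≤ m 0# (λ _ → 0#)
  zeroPolynomial zero    = lift λ _ → refl
  zeroPolynomial (suc m) = weaken m (zeroPolynomial m)

  sumPolynomial : ∀ m {k} (f : Fin k → Carrier → Carrier) → (∀ i → Polynomial≤ m 0# (f i)) →
    Polynomial≤ m 0# (λ x → sum λ i → f i x)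
  sumPolynomial m {zero}  f pf = zeroPolynomial m
  sumPolynomial m {suc k} f pf = respects m (+-identityˡ 0#) (λ _ → refl)
    (add m (pf zero) (sumPolynomial m (f ∘ suc) (pf ∘ suc)))

  module _ (integral : ∀ {x y} → x * y ≈ 0# → x ≉ 0# → y ≈ 0#) where

    -- Splitting off the first root leaves a divided difference of lower degree with the same top
    -- coefficient, and in an integral ring it vanishes at all other roots. Each step uses up one
    -- degree and one root.
    manyRoots⇒lead≈0 : ∀ m {a f} → Polynomial≤ m a f →
      (root : Fin (suc m) → Carrier) → (∀ {i j} → root i ≈ root j → i ≡ j) →
      (∀ i → f (root i) ≈ 0#) → a ≈ 0#
    manyRoots⇒lead≈0 zero    (lift f≈a) root inj f≈0 =
      trans (sym (f≈a (root zero))) (f≈0 zero)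
    manyRoots⇒lead≈0 (suc m) {f = f} pf root inj f≈0 with pf (root zero)
    ... | g , pg , eq = manyRoots⇒lead≈0 m pg (root ∘ suc)
      (Fin.suc-injective ∘ inj) λ i → integral (g-root i) (d≉0 i)
      where
      d : ∀ i → Carrier
      d i = root (suc i) - root zero

      r+d : ∀ i → root (suc i) ≈ root zero + d i
      r+d i = begin
        root (suc i)                              ≈⟨ +-identityˡ _ ⟨
        0# + root (suc i)                         ≈⟨ +-congʳ (-‿inverseʳ (root zero)) ⟨
        root zero - root zero + root (suc i)      ≈⟨ +-assoc _ _ _ ⟩
        root zero + (- root zero + root (suc i))  ≈⟨ +-congˡ (+-comm _ _) ⟩
        root zero + d i                           ∎

      d≉0 : ∀ i → d i ≉ 0#
      d≉0 i d≈0 with inj {suc i} {zero} (trans (r+d i) (trans (+-congˡ d≈0) (+-identityʳ _)))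
      ... | ()

      g-root : ∀ i → d i * g (root (suc i)) ≈ 0#
      g-root i = begin
        d i * g (root (suc i))                  ≈⟨ +-identityˡ _ ⟨
        0# + d i * g (root (suc i))             ≈⟨ +-congʳ (f≈0 zero) ⟨
        f (root zero) + d i * g (root (suc i))  ≈⟨ eq (root (suc i)) (d i) (r+d i) ⟨
        f (root (suc i))                        ≈⟨ f≈0 (suc i) ⟩
        0#                                      ∎

-- Finite fields: decidable equality, characteristic and x^q = x.

module FiniteField (K : CommutativeRing c ℓ) {q : ℕ} (isField : IsFieldOfOrder K q) where
  open CommutativeRing K hiding (zero)
  open IsFieldOfOrder isField
  open Inverse enumeration using (to; from; to-cong; strictlyInverseˡ; strictlyInverseʳ)
  open Exp commutativeSemiring
  open Mult semiring using () renaming (_×_ to _×ₙ_)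
  open SetoidReasoning setoid
  private
    module Σ = SemiringSum semiring
    module Π = MonoidSum *-commutativeMonoid

  infix 4 _≟_
  _≟_ : ∀ x y → Dec (x ≈ y)
  x ≟ y with to x Fin.≟ to y
  ... | yes eq = yes (begin
    x            ≈⟨ strictlyInverseʳ x ⟨
    from (to x)  ≡⟨ cong from eq ⟩
    from (to y)  ≈⟨ strictlyInverseʳ y ⟩
    y            ∎)
  ... | no neq = no (neq ∘ to-cong)

  from-injective : ∀ {i j} → from i ≈ from j → i ≡ j
  from-injective {i} {j} eq =
    ≡.trans (≡.sym (strictlyInverseˡ i)) (≡.trans (to-cong eq) (strictlyInverseˡ j))

  integral : ∀ {x y} → x * y ≈ 0# → x ≉ 0# → y ≈ 0#
  integral {x} {y} xy≈0 x≉0 with invertible x x≉0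
  ... | x⁻¹ , x⁻¹x≈1 , _ = begin
    y              ≈⟨ *-identityˡ y ⟨
    1# * y         ≈⟨ *-congʳ x⁻¹x≈1 ⟨
    x⁻¹ * x * y    ≈⟨ *-assoc x⁻¹ x y ⟩
    x⁻¹ * (x * y)  ≈⟨ *-congˡ xy≈0 ⟩
    x⁻¹ * 0#       ≈⟨ zeroʳ x⁻¹ ⟩
    0#             ∎

  module _ {c′ ℓ′} (M : CommutativeMonoid c′ ℓ′) where
    private
      module M = CommutativeMonoid M
    open MonoidSum M using (sum; sum-cong-≋)

    -- Sums over all of K are invariant under bijections of K. Translation by 1 will yield q · 1 =
    -- 0, and multiplication by x will yield x^q = x.
    sum-bijection : (f : Carrier → M.Carrier) → (∀ {x y} → x ≈ y → f x M.≈ f y) →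
      (φ ψ : Carrier → Carrier) →
      (∀ {x y} → x ≈ y → φ x ≈ φ y) → (∀ {x y} → x ≈ y → ψ x ≈ ψ y) →
      (∀ x → φ (ψ x) ≈ x) → (∀ x → ψ (φ x) ≈ x) →
      sum (f ∘ from) M.≈ sum (f ∘ φ ∘ from)
    sum-bijection f f-cong φ ψ φ-cong ψ-cong φψ ψφ = M.trans
      (sum-reindex M (f ∘ from) (to ∘ φ ∘ from) (to ∘ ψ ∘ from)
        (cancel φ ψ φ-cong φψ) (cancel ψ φ ψ-cong ψφ))
      (sum-cong-≋ λ i → f-cong (strictlyInverseʳ (φ (from i))))
      where
      cancel : ∀ φ ψ → (∀ {x y} → x ≈ y → φ x ≈ φ y) → (∀ x → φ (ψ x) ≈ x) →
        ∀ i → to (φ (from (to (ψ (from i))))) ≡ i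
      cancel φ ψ φ-cong φψ i = ≡.trans
        (to-cong (trans (φ-cong (strictlyInverseʳ (ψ (from i)))) (φψ (from i))))
        (strictlyInverseˡ i)

  -- The translation y ↦ y + 1 permutes K, so it preserves the sum of all elements; yet it adds q ·
  -- 1 to that sum.
  q×1≈0 : q ×ₙ 1# ≈ 0#
  q×1≈0 = begin
    q ×ₙ 1#                              ≈⟨ Σ.sum-replicate q ⟨
    Σ.sum {q} (λ _ → 1#)                 ≈⟨ +-identityˡ _ ⟨
    0# + Σ.sum {q} (λ _ → 1#)            ≈⟨ +-congʳ (-‿inverseˡ total) ⟨
    - total + total + Σ.sum {q} (λ _ → 1#)    ≈⟨ +-assoc _ _ _ ⟩
    - total + (total + Σ.sum {q} (λ _ → 1#))  ≈⟨ +-congˡ (Σ.∑-distrib-+ from (λ _ → 1#)) ⟨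
    - total + Σ.sum (λ i → from i + 1#)  ≈⟨ +-congˡ (sum-bijection +-commutativeMonoid (λ x → x) (λ eq → eq)
                                              (_+ 1#) (_- 1#) +-congʳ +-congʳ
                                              (λ x → trans (+-assoc _ _ _) (trans (+-congˡ (-‿inverseˡ 1#)) (+-identityʳ x)))
                                              (λ x → trans (+-assoc _ _ _) (trans (+-congˡ (-‿inverseʳ 1#)) (+-identityʳ x)))) ⟨
    - total + total                      ≈⟨ -‿inverseˡ total ⟩
    0#                                   ∎
    where
    total = Σ.sum from

  ifZero : ∀ {a} {A : Set a} → Carrier → A → A → A
  ifZero y a b = if does (y ≟ 0#) then a else b

  ifZero-yes : ∀ {y} {a b : Carrier} → y ≈ 0# → ifZero y a b ≈ a
  ifZero-yes {y} y≈0 with y ≟ 0#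
  ... | yes _   = refl
  ... | no  y≉0 = ⊥-elim (y≉0 y≈0)

  ifZero-no : ∀ {y} {a b : Carrier} → y ≉ 0# → ifZero y a b ≈ b
  ifZero-no {y} y≉0 with y ≟ 0#
  ... | yes y≈0 = ⊥-elim (y≉0 y≈0)
  ... | no  _   = refl

  x*y≉0 : ∀ {x y} → x ≉ 0# → y ≉ 0# → x * y ≉ 0#
  x*y≉0 x≉0 y≉0 xy≈0 = y≉0 (integral xy≈0 x≉0)

  product≉0 : ∀ {m} (v : Vector Carrier m) → (∀ i → v i ≉ 0#) → Π.sum v ≉ 0#
  product≉0 {zero}  v v≉0 = 1≉0
  product≉0 {suc m} v v≉0 = x*y≉0 (v≉0 zero) (product≉0 (v ∘ suc) (v≉0 ∘ suc))

  -- The product of the nonzero elements is invariant under y ↦ xy.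
  x^q≈x : ∀ x → x ^ q ≈ x
  x^q≈x x with x ≟ 0#
  ... | yes x≈0 = trans (^-congˡ q x≈0) (trans (0^ (to 0#)) (sym x≈0))
    where
    -- An inhabitant of `Fin m` makes m positive; `to 0#` supplies one for q.
    0^ : ∀ {m} → Fin m → 0# ^ m ≈ 0#
    0^ {suc m} _ = zeroˡ _
  ... | no x≉0 with invertible x x≉0
  ... | x⁻¹ , x⁻¹x≈1 , xx⁻¹≈1 = begin
    x ^ q                                ≈⟨ Π.sum-replicate q ⟨
    Π.sum {q} (λ _ → x)                  ≈⟨ Π.sum-cong-≋ (λ i → factor (from i)) ⟨
    Π.sum (λ i → e (from i) * d (from i)) ≈⟨ Π.∑-distrib-+ (e ∘ from) (d ∘ from) ⟩
    Π.sum (e ∘ from) * Π.sum (d ∘ from)  ≈⟨ *-cong Πe≈1 Πd≈x ⟩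
    1# * x                               ≈⟨ *-identityˡ x ⟩
    x                                    ∎
    where
    -- Products run over all of K, so `unit` replaces the element 0 by 1. Each of the q factors x is
    -- split as e y * d y: `e` carries it at nonzero y, where multiplication by x permutes, and `d`
    -- carries the single factor left over at y = 0.
    unit e d : Carrier → Carrier
    unit y = ifZero y 1# y
    e y = ifZero y 1# x
    d y = ifZero y x 1#

    factor : ∀ y → e y * d y ≈ x
    factor y with y ≟ 0#
    ... | yes _ = *-identityˡ x
    ... | no  _ = *-identityʳ x

    unit≉0 : ∀ y → unit y ≉ 0#
    unit≉0 y with y ≟ 0#
    ... | yes _   = 1≉0
    ... | no  y≉0 = y≉0

    unit-cong : ∀ {y z} → y ≈ z → unit y ≈ unit z
    unit-cong {y} {z} y≈z with y ≟ 0#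
    ... | yes y≈0 = sym (ifZero-yes (trans (sym y≈z) y≈0))
    ... | no  y≉0 = trans y≈z (sym (ifZero-no (y≉0 ∘ trans y≈z)))

    unit-* : ∀ y → unit (x * y) ≈ e y * unit y
    unit-* y with y ≟ 0#
    ... | yes y≈0 = trans (ifZero-yes (trans (*-congˡ y≈0) (zeroʳ x))) (sym (*-identityˡ 1#))
    ... | no  y≉0 = ifZero-no (x*y≉0 x≉0 y≉0)

    P = Π.sum (unit ∘ from)

    P≈Πe*P : P ≈ Π.sum (e ∘ from) * P
    P≈Πe*P = begin
      P                                          ≈⟨ sum-bijection *-commutativeMonoid unit unit-cong
                                                      (x *_) (x⁻¹ *_) *-congˡ *-congˡ
                                                      (λ y → trans (sym (*-assoc x x⁻¹ y)) (trans (*-congʳ xx⁻¹≈1) (*-identityˡ y)))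
                                                      (λ y → trans (sym (*-assoc x⁻¹ x y)) (trans (*-congʳ x⁻¹x≈1) (*-identityˡ y))) ⟩
      Π.sum (λ i → unit (x * from i))            ≈⟨ Π.sum-cong-≋ (λ i → unit-* (from i)) ⟩
      Π.sum (λ i → e (from i) * unit (from i))   ≈⟨ Π.∑-distrib-+ (e ∘ from) (unit ∘ from) ⟩
      Π.sum (e ∘ from) * P                       ∎

    Πe≈1 : Π.sum (e ∘ from) ≈ 1#
    Πe≈1 with invertible P (product≉0 (unit ∘ from) (unit≉0 ∘ from))
    ... | P⁻¹ , _ , PP⁻¹≈1 = begin
      Π.sum (e ∘ from)              ≈⟨ *-identityʳ _ ⟨
      Π.sum (e ∘ from) * 1#         ≈⟨ *-congˡ PP⁻¹≈1 ⟨
      Π.sum (e ∘ from) * (P * P⁻¹)  ≈⟨ *-assoc _ P P⁻¹ ⟨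
      Π.sum (e ∘ from) * P * P⁻¹    ≈⟨ *-congʳ P≈Πe*P ⟨
      P * P⁻¹                       ≈⟨ PP⁻¹≈1 ⟩
      1#                            ∎

    Πd≈x : Π.sum (d ∘ from) ≈ x
    Πd≈x = trans
      (sum-single *-commutativeMonoid (d ∘ from) (to 0#) λ j j≢ → ifZero-no λ from≈0 →
        j≢ (≡.trans (≡.sym (strictlyInverseˡ j)) (to-cong from≈0)))
      (ifZero-yes (strictlyInverseʳ 0#))

-- Fields of order 2^n and linearized polynomials.

module BinaryField (K : CommutativeRing c ℓ) {n : ℕ} (isField : IsFieldOfOrder K (2 ℕ.^ n)) where
  open CommutativeRing K hiding (zero)
  open IsFieldOfOrder isField
  open Inverse enumeration using (from)
  open FiniteField K isField public
  open Exp commutativeSemiring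
  open Mult semiring using (×1-homo-*) renaming (_×_ to _×ₙ_)
  open SemiringSum semiring
  open PolynomialFunctions K
  open SetoidReasoning setoid

  -- If 2 were nonzero, so would be its n-th power, K being integral; but 2^n · 1 = 0.
  1+1≈0 : 1# + 1# ≈ 0#
  1+1≈0 with 1# + 1# ≟ 0#
  ... | yes eq = eq
  ... | no  2≉0 = ⊥-elim (2^n×1≉0 n q×1≈0)
    where
    2^n×1≉0 : ∀ m → (2 ℕ.^ m) ×ₙ 1# ≉ 0#
    2^n×1≉0 zero    eq = 1≉0 (trans (sym (+-identityʳ 1#)) eq)
    2^n×1≉0 (suc m) eq = x*y≉0 (2≉0 ∘ trans (+-congˡ (sym (+-identityʳ 1#)))) (2^n×1≉0 m)
      (trans (sym (×1-homo-* 2 (2 ℕ.^ m))) eq)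

  open CharacteristicTwoProperties K 1+1≈0 public

  -- The sum is a polynomial function of degree at most 2^m with top coefficient `last d`. As m < n,
  -- the field contains 2^m + 1 distinct elements, all of them roots.
  linearized-last≈0 : ∀ {m} → m < n → (d : Vector Carrier (suc m)) →
    (∀ x → sum (λ i → d i * x ^ (2 ℕ.^ toℕ i)) ≈ 0#) → last d ≈ 0#
  linearized-last≈0 {m} m<n d vanishes =
    manyRoots⇒lead≈0 integral (2 ℕ.^ m) polynomial
      (λ i → from (inject≤ i (ℕ.^-monoʳ-< 2 ℕ.≤-refl m<n)))
      (inject≤-injective _ _ _ _ ∘ from-injective)
      (λ i → vanishes _)
    where
    term : Fin (suc m) → Carrier → Carrier
    term i x = d i * x ^ (2 ℕ.^ toℕ i)

    low : ∀ i → Polynomial≤ (2 ℕ.^ m) 0# (term (inject₁ i))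
    low i = weaken-<
      (ℕ.^-monoʳ-< 2 ℕ.≤-refl (ℕ.≤-<-trans (ℕ.≤-reflexive (toℕ-inject₁ i)) (toℕ<n i)))
      (scale _ (d (inject₁ i)) (power _))

    top : Polynomial≤ (2 ℕ.^ m) (last d) (term (fromℕ m))
    top = respects (2 ℕ.^ m) (*-identityʳ _)
      (λ x → *-congˡ (^-congʳ x (cong (2 ℕ.^_) (≡.sym (toℕ-fromℕ m)))))
      (scale (2 ℕ.^ m) (last d) (power (2 ℕ.^ m)))

    polynomial : Polynomial≤ (2 ℕ.^ m) (last d) (λ x → sum λ i → term i x)
    polynomial = respects (2 ℕ.^ m) (+-identityˡ _)
      (λ x → sym (sum-init-last λ i → term i x))
      (add (2 ℕ.^ m) (sumPolynomial (2 ℕ.^ m) (term ∘ inject₁) low) top)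

  -- Linear independence of the powers of Frobenius, obtained by removing vanishing top coefficients
  -- one after another.
  linearized-injective : ∀ {m} → m ≤ n → (d : Vector Carrier m) →
    (∀ x → sum (λ i → d i * x ^ (2 ℕ.^ toℕ i)) ≈ 0#) → ∀ i → d i ≈ 0#
  linearized-injective {suc m} m<n d vanishes i with view i
  ... | ‵fromℕ     = linearized-last≈0 m<n d vanishes
  ... | ‵inject₁ j = linearized-injective (ℕ.<⇒≤ m<n) (init d) init-vanishes j
    where
    init-vanishes : ∀ x → sum (λ i → init d i * x ^ (2 ℕ.^ toℕ i)) ≈ 0#
    init-vanishes x = begin
      sum (λ i → init d i * x ^ (2 ℕ.^ toℕ i))
        ≈⟨ sum-cong-≋ {m} (λ i → *-congˡ {init d i} (^-congʳ x (cong (2 ℕ.^_) (toℕ-inject₁ i)))) ⟨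
      sum (init term)
        ≈⟨ +-identityʳ _ ⟨
      sum (init term) + 0#
        ≈⟨ +-congˡ (trans (*-congʳ (linearized-last≈0 m<n d vanishes)) (zeroˡ _)) ⟨
      sum (init term) + last term
        ≈⟨ sum-init-last term ⟨
      sum term
        ≈⟨ vanishes x ⟩
      0# ∎
      where
      term : Vector Carrier (suc m)
      term i = d i * x ^ (2 ℕ.^ toℕ i)

-- Polynomials over `𝔽₂`: evaluation, reduction modulo xⁿ - 1, Bézout identities.

module ℙ where
  open PolynomialRing 𝔽₂ using (poly-commutativeRing) public
  open CommutativeRing poly-commutativeRing public hiding (zero)
  open Exp commutativeSemiring public
  open SemiringSum semiring public

module Evaluation (R : CommutativeRing c ℓ)
  (1+1≈0 : CharacteristicTwo R)
  (x : CommutativeRing.Carrier R) where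
  open CommutativeRing R hiding (zero)
  open Exp commutativeSemiring
  open SemiringSum semiring
  open Extension R using (ι)
  open Solver commutativeSemiring using (solve; _:+_; _:*_; _:=_)
  open SetoidReasoning setoid
  open 𝔽₂[X] using (Poly; X; fromVector; xⁿ-1; mk≈ₚ; _≈ₚ_)
  open _≈ₚ_

  ι-xor : ∀ a b → ι (a xor b) ≈ ι a + ι b
  ι-xor false b     = sym (+-identityˡ (ι b))
  ι-xor true  false = sym (+-identityʳ 1#)
  ι-xor true  true  = sym 1+1≈0

  ι-∧ : ∀ a b → ι (a ∧ b) ≈ ι a * ι b
  ι-∧ false b = sym (zeroˡ (ι b))
  ι-∧ true  b = sym (*-identityˡ (ι b))

  eval : Poly → Carrier
  eval []      = 0#
  eval (a ∷ p) = ι a + x * eval p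

  eval≈0 : ∀ {p} → p ≈ₚ [] → eval p ≈ 0#
  eval≈0 {[]}    p≈0 = refl
  eval≈0 {a ∷ p} p≈0 = begin
    ι a + x * eval p  ≈⟨ +-cong (reflexive (cong ι (coeff-≈ p≈0 0)))
                           (*-congˡ (eval≈0 {p} (mk≈ₚ (coeff-≈ p≈0 ∘ suc)))) ⟩
    0# + x * 0#       ≈⟨ +-identityˡ _ ⟩
    x * 0#            ≈⟨ zeroʳ x ⟩
    0#                ∎

  eval-cong : ∀ {p q} → p ≈ₚ q → eval p ≈ eval q
  eval-cong {[]}    {q}     p≈q = sym (eval≈0 (ℙ.sym p≈q))
  eval-cong {a ∷ p} {[]}    p≈q = eval≈0 p≈q
  eval-cong {a ∷ p} {b ∷ q} p≈q = +-cong (reflexive (cong ι (coeff-≈ p≈q 0)))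
    (*-congˡ (eval-cong {p} {q} (mk≈ₚ (coeff-≈ p≈q ∘ suc))))

  eval-+ : ∀ p q → eval (p ℙ.+ q) ≈ eval p + eval q
  eval-+ []      q       = sym (+-identityˡ _)
  eval-+ (a ∷ p) []      = sym (+-identityʳ _)
  eval-+ (a ∷ p) (b ∷ q) = begin
    ι (a xor b) + x * eval (p ℙ.+ q)       ≈⟨ +-cong (ι-xor a b) (*-congˡ (eval-+ p q)) ⟩
    ι a + ι b + x * (eval p + eval q)      ≈⟨ solve 5 (λ a b x p q → a :+ b :+ x :* (p :+ q) :=
                                                a :+ x :* p :+ (b :+ x :* q))
                                                refl (ι a) (ι b) x (eval p) (eval q) ⟩
    ι a + x * eval p + (ι b + x * eval q)  ∎

  eval-scale : ∀ a p → eval (map (a ∧_) p) ≈ ι a * eval p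
  eval-scale a []      = sym (zeroʳ (ι a))
  eval-scale a (b ∷ p) = begin
    ι (a ∧ b) + x * eval (map (a ∧_) p)  ≈⟨ +-cong (ι-∧ a b) (*-congˡ (eval-scale a p)) ⟩
    ι a * ι b + x * (ι a * eval p)       ≈⟨ solve 4 (λ a b x p → a :* b :+ x :* (a :* p) :=
                                              a :* (b :+ x :* p)) refl (ι a) (ι b) x (eval p) ⟩
    ι a * (ι b + x * eval p)             ∎

  eval-* : ∀ p q → eval (p ℙ.* q) ≈ eval p * eval q
  eval-* []      q = sym (zeroˡ _)
  eval-* (a ∷ p) q = begin
    eval (map (a ∧_) q ℙ.+ (false ∷ p ℙ.* q))      ≈⟨ eval-+ (map (a ∧_) q) (false ∷ p ℙ.* q) ⟩
    eval (map (a ∧_) q) + (0# + x * eval (p ℙ.* q))  ≈⟨ +-cong (eval-scale a q)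
                                                        (trans (+-identityˡ _) (*-congˡ (eval-* p q))) ⟩
    ι a * eval q + x * (eval p * eval q)           ≈⟨ solve 4 (λ a x p q → a :* q :+ x :* (p :* q) :=
                                                        (a :+ x :* p) :* q) refl (ι a) x (eval p) (eval q) ⟩
    (ι a + x * eval p) * eval q                    ∎

  eval-1 : eval ℙ.1# ≈ 1#
  eval-1 = trans (+-congˡ (zeroʳ x)) (+-identityʳ 1#)

  eval-X : eval X ≈ x
  eval-X = trans (+-identityˡ _) (trans (*-congˡ eval-1) (*-identityʳ x))

  eval-X^ : ∀ n → eval (X ℙ.^ n) ≈ x ^ n
  eval-X^ zero    = eval-1
  eval-X^ (suc n) = trans (eval-* X (X ℙ.^ n)) (*-cong eval-X (eval-X^ n))

  eval-xⁿ-1 : ∀ n → x ^ n ≈ 1# → eval (xⁿ-1 n) ≈ 0#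
  eval-xⁿ-1 n xⁿ≈1 = begin
    -- The coefficient -1 computes to 1 in `𝔽₂`, so `xⁿ-1 n` unfolds to the sum of X^n and 1.
    eval (xⁿ-1 n)                  ≈⟨ eval-+ (X ℙ.^ n) ℙ.1# ⟩
    eval (X ℙ.^ n) + eval ℙ.1#     ≈⟨ +-cong (trans (eval-X^ n) xⁿ≈1) eval-1 ⟩
    1# + 1#                        ≈⟨ 1+1≈0 ⟩
    0#                             ∎

  eval-fromVector : ∀ {n} (v : Vector Bool n) →
    eval (fromVector v) ≈ sum λ i → ι (v i) * x ^ toℕ i
  eval-fromVector {zero}  v = refl
  eval-fromVector {suc n} v = +-cong (sym (*-identityʳ _)) (begin
    x * eval (fromVector (v ∘ suc))
      ≈⟨ *-congˡ (eval-fromVector (v ∘ suc)) ⟩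
    x * sum (λ i → ι (v (suc i)) * x ^ toℕ i)
      ≈⟨ *-distribˡ-sum x (λ i → ι (v (suc i)) * x ^ toℕ i) ⟩
    sum (λ i → x * (ι (v (suc i)) * x ^ toℕ i))
      ≈⟨ sum-cong-≋ (λ i → solve 3 (λ x a y → x :* (a :* y) := a :* (x :* y)) refl
           x (ι (v (suc i))) (x ^ toℕ i)) ⟩
    sum (λ i → ι (v (suc i)) * x ^ toℕ (suc i)) ∎)

module 𝔽₂-Polynomials where
  open PolynomialRing 𝔽₂ using (∷-cong; 0∷≈[]; 0∷-*ₚ)
  open 𝔽₂[X] using (Poly; X; fromVector; xⁿ-1)

  1+1≈0ₚ : ℙ.1# ℙ.+ ℙ.1# ℙ.≈ ℙ.0#
  1+1≈0ₚ = 0∷≈[] ℙ.refl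

  module ℙ₂ = CharacteristicTwoProperties ℙ.poly-commutativeRing 1+1≈0ₚ

  X*p : ∀ p → X ℙ.* p ℙ.≈ false ∷ p
  X*p p = ℙ.trans (0∷-*ₚ (true ∷ []) p) (∷-cong ≡.refl (ℙ.*-identityˡ p))

  private
    module Id = Evaluation ℙ.poly-commutativeRing 1+1≈0ₚ X

  open Extension ℙ.poly-commutativeRing using () renaming (ι to constant)

  constant-+-0∷ : ∀ a p → constant a ℙ.+ (false ∷ p) ℙ.≈ a ∷ p
  constant-+-0∷ false p = ℙ.refl
  constant-+-0∷ true  p = ℙ.refl

  -- Evaluation at the indeterminate itself turns the general `eval-fromVector` into an expansion of
  -- a coefficient list as a sum of monomials.
  eval-X≈id : ∀ p → Id.eval p ℙ.≈ p
  eval-X≈id []      = ℙ.refl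
  eval-X≈id (a ∷ p) = begin
    constant a ℙ.+ X ℙ.* Id.eval p  ≈⟨ ℙ.+-congˡ {constant a} (ℙ.*-congˡ {X} (eval-X≈id p)) ⟩
    constant a ℙ.+ X ℙ.* p          ≈⟨ ℙ.+-congˡ (X*p p) ⟩
    constant a ℙ.+ (false ∷ p)      ≈⟨ constant-+-0∷ a p ⟩
    a ∷ p                           ∎
    where open SetoidReasoning ℙ.setoid

  fromVector≈sum : ∀ {n} (v : Vector Bool n) →
    fromVector v ℙ.≈ ℙ.sum λ i → constant (v i) ℙ.* X ℙ.^ toℕ i
  fromVector≈sum v = ℙ.trans (ℙ.sym (eval-X≈id (fromVector v))) (Id.eval-fromVector v)

  fromVector≈0 : ∀ {n} (v : Vector Bool n) → (∀ i → v i ≡ false) → fromVector v ℙ.≈ []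
  fromVector≈0 {zero}  v v≡0 = ℙ.refl
  fromVector≈0 {suc n} v v≡0 = ℙ.trans (∷-cong (v≡0 zero) ℙ.refl)
    (0∷≈[] (fromVector≈0 (v ∘ suc) (v≡0 ∘ suc)))

  ∷≈+X* : ∀ a p → a ∷ p ℙ.≈ constant a ℙ.+ X ℙ.* p
  ∷≈+X* a p = ℙ.sym (ℙ.trans (ℙ.+-congˡ (X*p p)) (constant-+-0∷ a p))

  -- Remainder modulo xⁿ - 1 of a polynomial of degree at most n, for n = `suc m`: the coefficient
  -- of x^n is folded onto the constant one.
  wrap : ∀ {m} → Vector Bool (suc (suc m)) → Vector Bool (suc m)
  wrap w zero    = w zero xor last w
  wrap w (suc i) = w (inject₁ (suc i))

  fromVector-wrap : ∀ {m} (w : Vector Bool (suc (suc m))) →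
    fromVector w ℙ.≈ constant (last w) ℙ.* xⁿ-1 (suc m) ℙ.+ fromVector (wrap w)
  fromVector-wrap {m} w = begin
    fromVector w
      ≈⟨ fromVector≈sum w ⟩
    ℙ.sum term
      ≈⟨ ℙ.sum-init-last term ⟩
    a ℙ.* ℙ.1# ℙ.+ low ℙ.+ t ℙ.* X ℙ.^ toℕ (fromℕ (suc m))
      ≈⟨ ℙ.+-congˡ {a ℙ.* ℙ.1# ℙ.+ low} (ℙ.*-congˡ {t} (ℙ.^-congʳ X (toℕ-fromℕ (suc m)))) ⟩
    a ℙ.* ℙ.1# ℙ.+ low ℙ.+ t ℙ.* Xⁿ
      -- Adding `t` twice changes nothing: one copy completes t X^n to a multiple of X^n + 1, the
      -- other joins the constant coefficient.
      ≈⟨ ℙ₂.x+[x+y]≈y t _ ⟨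
    t ℙ.+ (t ℙ.+ (a ℙ.* ℙ.1# ℙ.+ low ℙ.+ t ℙ.* Xⁿ))
      ≈⟨ solve 4 (λ t a l x → t :+ (t :+ (a :* con 1 :+ l :+ t :* x)) :=
           t :* (x :+ con 1) :+ ((a :+ t) :* con 1 :+ l)) ℙ.refl t a low Xⁿ ⟩
    t ℙ.* xⁿ-1 (suc m) ℙ.+ ((a ℙ.+ t) ℙ.* ℙ.1# ℙ.+ low)
      ≈⟨ ℙ.+-congˡ {t ℙ.* xⁿ-1 (suc m)} (ℙ.+-cong (ℙ.*-congʳ {ℙ.1#} (Id.ι-xor (w zero) (last w)))
           (ℙ.sum-cong-≋ {m} λ i → ℙ.*-congˡ {constant (w (suc (inject₁ i)))}
             (ℙ.^-congʳ X (cong suc (≡.sym (toℕ-inject₁ i)))))) ⟨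
    t ℙ.* xⁿ-1 (suc m) ℙ.+ ℙ.sum (λ i → constant (wrap w i) ℙ.* X ℙ.^ toℕ i)
      ≈⟨ ℙ.+-congˡ {t ℙ.* xⁿ-1 (suc m)} (fromVector≈sum (wrap w)) ⟨
    t ℙ.* xⁿ-1 (suc m) ℙ.+ fromVector (wrap w) ∎
    where
    open SetoidReasoning ℙ.setoid
    open Solver ℙ.commutativeSemiring using (solve; _:+_; _:*_; _:=_; con)
    term : Vector Poly (suc (suc m))
    term i = constant (w i) ℙ.* X ℙ.^ toℕ i
    a t low Xⁿ : Poly
    a = constant (w zero)
    t = constant (last w)
    low = ℙ.sum (λ i → term (suc (inject₁ i)))
    Xⁿ = X ℙ.^ suc m

  -- Horner's scheme: the remainder of the tail is multiplied by X, receives the new constant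
  -- coefficient and is folded once.
  divMod-xⁿ-1 : ∀ m p → ∃₂ λ h (v : Vector Bool (suc m)) →
    p ℙ.≈ h ℙ.* xⁿ-1 (suc m) ℙ.+ fromVector v
  divMod-xⁿ-1 m []      = [] , (λ _ → false) , ℙ.sym (fromVector≈0 {suc m} (λ _ → false) λ _ → ≡.refl)
  divMod-xⁿ-1 m (a ∷ p) with divMod-xⁿ-1 m p
  ... | h , v , p≈ = X ℙ.* h ℙ.+ constant (last w) , wrap w , (begin
    a ∷ p                                          ≈⟨ ∷≈+X* a p ⟩
    A ℙ.+ X ℙ.* p                                  ≈⟨ ℙ.+-congˡ {A} (ℙ.*-congˡ {X} p≈) ⟩
    A ℙ.+ X ℙ.* (h ℙ.* M ℙ.+ fromVector v)         ≈⟨ solve 5 (λ a x h m v → a :+ x :* (h :* m :+ v) :=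
                                                        x :* h :* m :+ (a :+ x :* v))
                                                        ℙ.refl A X h M (fromVector v) ⟩
    X ℙ.* h ℙ.* M ℙ.+ (A ℙ.+ X ℙ.* fromVector v)   ≈⟨ ℙ.+-congˡ {X ℙ.* h ℙ.* M} (∷≈+X* a (fromVector v)) ⟨
    X ℙ.* h ℙ.* M ℙ.+ fromVector w                 ≈⟨ ℙ.+-congˡ {X ℙ.* h ℙ.* M} (fromVector-wrap w) ⟩
    X ℙ.* h ℙ.* M ℙ.+ (constant (last w) ℙ.* M ℙ.+ fromVector (wrap w))
                                                   ≈⟨ solve 4 (λ h t m v → h :* m :+ (t :* m :+ v) :=
                                                        (h :+ t) :* m :+ v)
                                                        ℙ.refl (X ℙ.* h) (constant (last w)) M (fromVector (wrap w)) ⟩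
    (X ℙ.* h ℙ.+ constant (last w)) ℙ.* M ℙ.+ fromVector (wrap w) ∎)
    where
    open SetoidReasoning ℙ.setoid
    open Solver ℙ.commutativeSemiring using (solve; _:+_; _:*_; _:=_)
    w : Vector Bool (suc (suc m))
    w = a Vector.∷ v
    A M : Poly
    A = constant a
    M = xⁿ-1 (suc m)

  open MagmaDefinitions ℙ.*-rawMagma public using ()
    renaming (_∣_ to infix 4 _∣ₚ_; _,_ to infixr 4 _,ₚ_)

  -- Modulo xⁿ - 1 the indeterminate is invertible, so a combination equal to X^k d serves as well
  -- there as one equal to d.
  record Bézout (p q : Poly) : Set where
    field
      d u v : Poly
      k     : ℕ
      d∣p   : d ∣ₚ p
      d∣q   : d ∣ₚ q
      combination : X ℙ.^ k ℙ.* d ℙ.≈ u ℙ.* p ℙ.+ v ℙ.* q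

  bézout-sym : ∀ {p q} → Bézout p q → Bézout q p
  bézout-sym b = record
    { d = d ; u = v ; v = u ; k = k ; d∣p = d∣q ; d∣q = d∣p
    ; combination = ℙ.trans combination (ℙ.+-comm (u ℙ.* _) (v ℙ.* _)) }
    where open Bézout b

  bézout-0 : ∀ q → Bézout [] q
  bézout-0 q = record
    { d = q ; u = [] ; v = ℙ.1# ; k = 0
    ; d∣p = [] ,ₚ ℙ.refl
    ; d∣q = ℙ.1# ,ₚ ℙ.*-identityˡ q
    ; combination = ℙ.refl
    }

  bézout-cong : ∀ {p p′ q} → p ℙ.≈ p′ → Bézout p q → Bézout p′ q
  bézout-cong p≈p′ b = record
    { d = d ; u = u ; v = v ; k = k
    ; d∣p = ∣-resp d∣p
    ; d∣q = d∣q
    ; combination = ℙ.trans combination (ℙ.+-congʳ (ℙ.*-congˡ {u} p≈p′))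
    }
    where
    open Bézout b
    ∣-resp : d ∣ₚ _ → d ∣ₚ _
    ∣-resp (w ,ₚ wd≈p) = w ,ₚ ℙ.trans wd≈p p≈p′

  -- A divisor of p also divides X p. Multiplying the combination by X turns the term u p into u (X
  -- p), at the cost of one more factor X on the left.
  bézout-X* : ∀ {p q} → Bézout p q → Bézout (X ℙ.* p) q
  bézout-X* {p} {q} b = record
    { d = d ; u = u ; v = X ℙ.* v ; k = suc k
    ; d∣p = ∣-X* d∣p
    ; d∣q = d∣q
    ; combination = begin
        X ℙ.* X ℙ.^ k ℙ.* d                      ≈⟨ ℙ.*-assoc X (X ℙ.^ k) d ⟩
        X ℙ.* (X ℙ.^ k ℙ.* d)                    ≈⟨ ℙ.*-congˡ {X} combination ⟩
        X ℙ.* (u ℙ.* p ℙ.+ v ℙ.* q)              ≈⟨ solve 5 (λ x u p v q → x :* (u :* p :+ v :* q) :=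
                                                      u :* (x :* p) :+ x :* v :* q) ℙ.refl X u p v q ⟩
        u ℙ.* (X ℙ.* p) ℙ.+ X ℙ.* v ℙ.* q        ∎
    }
    where
    open Bézout b
    open SetoidReasoning ℙ.setoid
    open Solver ℙ.commutativeSemiring using (solve; _:+_; _:*_; _:=_)
    ∣-X* : d ∣ₚ p → d ∣ₚ X ℙ.* p
    ∣-X* (w ,ₚ wd≈p) = X ℙ.* w ,ₚ ℙ.trans (ℙ.*-assoc X w d) (ℙ.*-congˡ {X} wd≈p)

  bézout-+ : ∀ {p q} → Bézout (p ℙ.+ q) q → Bézout p q
  bézout-+ {p} {q} b = record
    { d = d ; u = u ; v = u ℙ.+ v ; k = k
    ; d∣p = ∣-+ d∣p d∣q
    ; d∣q = d∣q
    ; combination = ℙ.trans combination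
        (solve 4 (λ u p v q → u :* (p :+ q) :+ v :* q := u :* p :+ (u :+ v) :* q) ℙ.refl u p v q)
    }
    where
    open Bézout b
    open SetoidReasoning ℙ.setoid
    open Solver ℙ.commutativeSemiring using (solve; _:+_; _:*_; _:=_)
    ∣-+ : d ∣ₚ p ℙ.+ q → d ∣ₚ q → d ∣ₚ p
    ∣-+ (w ,ₚ wd≈p+q) (w′ ,ₚ w′d≈q) = w′ ℙ.+ w ,ₚ (begin
      (w′ ℙ.+ w) ℙ.* d       ≈⟨ ℙ.distribʳ d w′ w ⟩
      w′ ℙ.* d ℙ.+ w ℙ.* d   ≈⟨ ℙ.+-cong w′d≈q (ℙ.trans wd≈p+q (ℙ.+-comm p q)) ⟩
      q ℙ.+ (q ℙ.+ p)        ≈⟨ ℙ₂.x+[x+y]≈y q p ⟩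
      p                      ∎)

  length-+ : ∀ p q {m} → length p ≤ m → length q ≤ m → length (p ℙ.+ q) ≤ m
  length-+ []      q       p≤m       q≤m       = q≤m
  length-+ (a ∷ p) []      p≤m       q≤m       = p≤m
  length-+ (a ∷ p) (b ∷ q) (s≤s p≤m) (s≤s q≤m) = s≤s (length-+ p q p≤m q≤m)

  -- The binary Euclidean algorithm cancels lowest terms, so that trailing zeros
  -- are harmless; the price is a power of X in the combination.
  bézout : ∀ p q → Bézout p q
  bézout p q = go _ p q ℕ.≤-refl
    where
    bézout-0∷ : ∀ {p q} → Bézout p q → Bézout (false ∷ p) q
    bézout-0∷ {p} b = bézout-cong (X*p p) (bézout-X* b)

    go : ∀ m p q → length p ℕ.+ length q ≤ m → Bézout p q
    go m       []          q           _ = bézout-0 q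
    go m       (a ∷ p)     []          _ = bézout-sym (bézout-0 (a ∷ p))
    go (suc m) (false ∷ p) (b ∷ q)     (s≤s l) = bézout-0∷ (go m p (b ∷ q) l)
    go (suc m) (true ∷ p)  (false ∷ q) l = bézout-sym (bézout-0∷ (go m q (true ∷ p)
      (s≤s⁻¹ (ℕ.≤-trans (ℕ.≤-reflexive (ℕ.+-comm (suc (length q)) (suc (length p)))) l))))
    -- Both constant terms are 1 and cancel in the sum. The longer list is replaced by the tail of
    -- that sum, which is shorter than it, so the total length drops.
    go (suc m) (true ∷ p)  (true ∷ q)  l with ℕ.≤-total (length q) (length p)
    ... | inj₁ q≤p = bézout-+ (bézout-0∷ (go m (p ℙ.+ q) (true ∷ q)
      (s≤s⁻¹ (ℕ.≤-trans (s≤s (ℕ.+-monoˡ-≤ _ (length-+ p q ℕ.≤-refl q≤p))) l))))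
    ... | inj₂ p≤q = bézout-sym (bézout-+ (bézout-0∷ (go m (q ℙ.+ p) (true ∷ p)
      (s≤s⁻¹ (ℕ.≤-trans (s≤s (ℕ.+-monoˡ-≤ _ (length-+ q p ℕ.≤-refl p≤q)))
        (ℕ.≤-trans (ℕ.≤-reflexive (ℕ.+-comm (suc (length q)) (suc (length p)))) l))))))

2∣n⊎2∣1+n : ∀ n → 2 ∣ n ⊎ 2 ∣ suc n
2∣n⊎2∣1+n zero = inj₁ (divides 0 ≡.refl)
2∣n⊎2∣1+n (suc n) with 2∣n⊎2∣1+n n
... | inj₁ (divides k n≡k*2) = inj₂ (divides (suc k) (cong (2 ℕ.+_) n≡k*2))
... | inj₂ 2∣1+n             = inj₁ 2∣1+n

-- Powers, and rings in which a power map is the identity.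

module Powers (R : CommutativeRing c ℓ) where
  open CommutativeRing R hiding (zero)
  open Exp commutativeSemiring
  open SetoidReasoning setoid

  ^-fixed : ∀ {x} a → x ^ a ≈ x → ∀ t → x ^ (a ℕ.^ t) ≈ x
  ^-fixed {x} a xᵃ≈x zero    = *-identityʳ x
  ^-fixed {x} a xᵃ≈x (suc t) = begin
    x ^ (a ℕ.* a ℕ.^ t)    ≈⟨ ^-assocʳ x a (a ℕ.^ t) ⟨
    (x ^ a) ^ (a ℕ.^ t)    ≈⟨ ^-congˡ (a ℕ.^ t) xᵃ≈x ⟩
    x ^ (a ℕ.^ t)          ≈⟨ ^-fixed a xᵃ≈x t ⟩
    x                      ∎

  1^ : ∀ j → 1# ^ j ≈ 1#
  1^ zero    = refl
  1^ (suc j) = trans (*-identityˡ _) (1^ j)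

  ^-comm : ∀ x a b → (x ^ a) ^ b ≈ (x ^ b) ^ a
  ^-comm x a b = trans (^-assocʳ x a b)
    (trans (^-congʳ x (ℕ.*-comm a b)) (sym (^-assocʳ x b a)))

  -- As x is fixed by (2k)ⁱ, raising the hypothesis to the power kⁱ cancels 2ⁱ.
  ^2^-cancel : ∀ {x} k i j → x ^ (2 ℕ.* k) ≈ x → x ^ (2 ℕ.^ i) ≈ x ^ (2 ℕ.^ (i ℕ.+ j)) →
    x ^ (2 ℕ.^ j) ≈ x
  ^2^-cancel {x} k i j x²ᵏ≈x eq = begin
    x ^ (2 ℕ.^ j)                              ≈⟨ ^-congˡ (2 ℕ.^ j) fixed ⟨
    ((x ^ (2 ℕ.^ i)) ^ (k ℕ.^ i)) ^ (2 ℕ.^ j)  ≈⟨ ^-comm _ (k ℕ.^ i) (2 ℕ.^ j) ⟩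
    ((x ^ (2 ℕ.^ i)) ^ (2 ℕ.^ j)) ^ (k ℕ.^ i)  ≈⟨ ^-congˡ (k ℕ.^ i) (^-assocʳ x (2 ℕ.^ i) (2 ℕ.^ j)) ⟩
    (x ^ (2 ℕ.^ i ℕ.* 2 ℕ.^ j)) ^ (k ℕ.^ i)    ≈⟨ ^-congˡ (k ℕ.^ i) (^-congʳ x (ℕ.^-distribˡ-+-* 2 i j)) ⟨
    (x ^ (2 ℕ.^ (i ℕ.+ j))) ^ (k ℕ.^ i)        ≈⟨ ^-congˡ (k ℕ.^ i) eq ⟨
    (x ^ (2 ℕ.^ i)) ^ (k ℕ.^ i)                ≈⟨ fixed ⟩
    x                                          ∎
    where
    [2k]ⁱ : ∀ i → 2 ℕ.^ i ℕ.* k ℕ.^ i ≡ (2 ℕ.* k) ℕ.^ i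
    [2k]ⁱ zero    = ≡.refl
    [2k]ⁱ (suc i) = ≡.trans (ℕ.[m*n]*[o*p]≡[m*o]*[n*p] 2 (2 ℕ.^ i) k (k ℕ.^ i))
      (cong (2 ℕ.* k ℕ.*_) ([2k]ⁱ i))

    fixed : (x ^ (2 ℕ.^ i)) ^ (k ℕ.^ i) ≈ x
    fixed = begin
      (x ^ (2 ℕ.^ i)) ^ (k ℕ.^ i)    ≈⟨ ^-assocʳ x (2 ℕ.^ i) (k ℕ.^ i) ⟩
      x ^ (2 ℕ.^ i ℕ.* k ℕ.^ i)      ≈⟨ ^-congʳ x ([2k]ⁱ i) ⟩
      x ^ ((2 ℕ.* k) ℕ.^ i)          ≈⟨ ^-fixed (2 ℕ.* k) x²ᵏ≈x i ⟩
      x                              ∎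

-- In such a ring every principal ideal (x) is generated by the idempotent
-- support x, and every finitely generated ideal is principal.
module PeriodicRing (R : CommutativeRing c ℓ)
  (1+1≈0 : CharacteristicTwo R)
  (p : ℕ)
  (x^[2+p]≈x : ∀ x → CommutativeRing._≈_ R
    (Exp._^_ (CommutativeRing.commutativeSemiring R) x (suc (suc p))) x) where
  open CommutativeRing R hiding (zero)
  open Exp commutativeSemiring
  open CharacteristicTwoProperties R 1+1≈0
  open Solver commutativeSemiring using (solve; _:+_; _:*_; _:=_; con)
  open SetoidReasoning setoid

  -- `support x ≈ 1#` is how unithood is expressed below: it unfolds to x * x ^ p ≈ 1#, which makes
  -- x ^ p the inverse.
  support : Carrier → Carrier
  support x = x ^ suc p

  x*support : ∀ x → x * support x ≈ x
  x*support = x^[2+p]≈x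

  [1+support]*x≈0 : ∀ x → (1# + support x) * x ≈ 0#
  [1+support]*x≈0 x = begin
    (1# + support x) * x  ≈⟨ solve 2 (λ s x → (con 1 :+ s) :* x := x :+ x :* s) refl (support x) x ⟩
    x + x * support x     ≈⟨ +-congˡ (x*support x) ⟩
    x + x                 ≈⟨ x+x≈0 x ⟩
    0#                    ∎

  support-unit : ∀ {x y} → x * y ≈ 1# → support x ≈ 1#
  support-unit {x} {y} xy≈1 = begin
    support x            ≈⟨ *-identityʳ _ ⟨
    support x * 1#       ≈⟨ *-congˡ xy≈1 ⟨
    support x * (x * y)  ≈⟨ solve 3 (λ s x y → s :* (x :* y) := x :* s :* y) refl (support x) x y ⟩
    x * support x * y    ≈⟨ *-congʳ (x*support x) ⟩
    x * y                ≈⟨ xy≈1 ⟩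
    1#                   ∎

  support-cong : ∀ {x y} → x ≈ y → support x ≈ support y
  support-cong = ^-congˡ (suc p)

  -- With e = `support x`, the summands live in complementary parts: e times the join is x, and (1 +
  -- e) times it is (1 + e) y. Hence it generates the ideal (x, y).
  join : Carrier → Carrier → Carrier
  join x y = x + (1# + support x) * y

  -- Multiplication by `support x` fixes x and kills the second summand of the join.
  join-annihilatorˡ : ∀ {t} x y → t * join x y ≈ 0# → t * x ≈ 0#
  join-annihilatorˡ {t} x y tj≈0 = begin
    t * x
      ≈⟨ solve 2 (λ t x → t :* x := t :* (x :+ con 0)) refl t x ⟩
    t * (x + 0#)
      ≈⟨ *-congˡ (+-cong (x*support x) (trans (*-congʳ (s*[1+s]≈0)) (zeroˡ y))) ⟨
    t * (x * s + s * (1# + s) * y)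
      ≈⟨ solve 4 (λ t x s y → t :* (x :* s :+ s :* (con 1 :+ s) :* y) :=
           t :* (x :+ (con 1 :+ s) :* y) :* s) refl t x s y ⟩
    t * join x y * s
      ≈⟨ trans (*-congʳ tj≈0) (zeroˡ s) ⟩
    0# ∎
    where
    s = support x
    s*[1+s]≈0 : s * (1# + s) ≈ 0#
    s*[1+s]≈0 = begin
      x * x ^ p * (1# + s)    ≈⟨ solve 3 (λ x xᵖ s → x :* xᵖ :* (con 1 :+ s) :=
                                   xᵖ :* ((con 1 :+ s) :* x)) refl x (x ^ p) s ⟩
      x ^ p * ((1# + s) * x)  ≈⟨ *-congˡ ([1+support]*x≈0 x) ⟩
      x ^ p * 0#              ≈⟨ zeroʳ _ ⟩
      0#                      ∎

  -- Once t kills x it kills `support x`, a multiple of x, so that t y = t (1 + `support x`) y,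
  -- which is t times the join.
  join-annihilatorʳ : ∀ {t} x y → t * join x y ≈ 0# → t * y ≈ 0#
  join-annihilatorʳ {t} x y tj≈0 = begin
    t * y                                    ≈⟨ +-identityˡ _ ⟨
    0# + t * y                               ≈⟨ +-cong (trans (*-congʳ tx≈0) (zeroˡ (x ^ p * y)))
                                                  refl ⟨
    t * x * (x ^ p * y) + t * y              ≈⟨ solve 4 (λ t x xᵖ y → t :* x :* (xᵖ :* y) :+ t :* y :=
                                                  t :* ((con 1 :+ x :* xᵖ) :* y)) refl t x (x ^ p) y ⟩
    t * ((1# + support x) * y)               ≈⟨ +-identityˡ _ ⟨
    0# + t * ((1# + support x) * y)          ≈⟨ +-congʳ tx≈0 ⟨
    t * x + t * ((1# + support x) * y)       ≈⟨ distribˡ t x _ ⟨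
    t * join x y                             ≈⟨ tj≈0 ⟩
    0#                                       ∎
    where
    tx≈0 = join-annihilatorˡ x y tj≈0

  -- Generation is recorded through annihilators: whatever kills g kills the whole family. The
  -- predicate `P` carries along a property stable under `join`; for orbits it is `Twisted`.
  commonGenerator : ∀ {a} (P : Carrier → Set a) → P 0# → (∀ {x y} → P x → P y → P (join x y)) →
    ∀ {m} (v : Vector Carrier m) → (∀ i → P (v i)) →
    ∃ λ g → P g × (∀ t → t * g ≈ 0# → ∀ i → t * v i ≈ 0#)
  commonGenerator P P0 Pjoin {zero}  v Pv = 0# , P0 , λ _ _ ()
  commonGenerator P P0 Pjoin {suc m} v Pv
    with commonGenerator P P0 Pjoin (v ∘ suc) (Pv ∘ suc)
  ... | g , Pg , annihilates = join (v zero) g , Pjoin (Pv zero) Pg , λ where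
    t tj≈0 zero    → join-annihilatorˡ (v zero) g tj≈0
    t tj≈0 (suc i) → annihilates t (join-annihilatorʳ (v zero) g tj≈0) i

-- The group ring of the cyclic group over K, with Frobenius acting on coefficients.

module CyclicAlgebra (K : CommutativeRing c ℓ)
  (1+1≈0 : CharacteristicTwo K)
  (m : ℕ) where
  open CommutativeRing K hiding (zero)
  open Exp commutativeSemiring
  open SemiringSum semiring
  open CharacteristicTwoProperties K 1+1≈0
  open Cyclic m public
  open GroupRing K ⊕-isAbelianGroup public
  open Extension K using (ι)

  module S where
    open CommutativeRing groupRing public hiding (zero)
    open Exp (CommutativeRing.commutativeSemiring groupRing) public
    open Powers groupRing public

  S-1+1≈0 : S.1# S.+ S.1# S.≈ S.0#
  S-1+1≈0 k = x+x≈0 (δ zero k)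

  module S₂ = CharacteristicTwoProperties groupRing S-1+1≈0

  X : S.Carrier
  X = δ [ 1 ]

  X⊛ : ∀ s k → (X S.* s) k ≈ s (k ⊝ [ 1 ])
  X⊛ = δ-⊛ [ 1 ]

  δ-⇔ : ∀ {i j i′ j′} → (i ≡ j → i′ ≡ j′) → (i′ ≡ j′ → i ≡ j) → δ i j ≈ δ i′ j′
  δ-⇔ {i} {j} f g with i Fin.≟ j
  ... | yes i≡j = sym (δ-≡ (f i≡j))
  ... | no  i≢j = sym (δ-≢ (i≢j ∘ g))

  δ-⊕ : ∀ i j → δ i S.* δ j S.≈ δ (i ⊕ j)
  δ-⊕ i j k = trans (δ-⊛ i (δ j) k) (δ-⇔
    (λ j≡k⊝i → ≡.trans (⊕-comm i j) (≡.trans (cong (_⊕ i) j≡k⊝i) (⊝-⊕ k i)))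
    (λ i⊕j≡k → ≡.trans (≡.sym (⊕-⊝ j i)) (cong (_⊝ i) (≡.trans (⊕-comm j i) i⊕j≡k))))

  X^≈δ : ∀ a → X S.^ a S.≈ δ [ a ]
  X^≈δ zero    = S.refl
  X^≈δ (suc a) = S.trans (S.*-congˡ {X} (X^≈δ a))
    (S.trans (δ-⊕ [ 1 ] [ a ]) (S.reflexive (cong δ ([]-+ 1 a))))

  X^-cong-[] : ∀ a b → [ a ] ≡ [ b ] → X S.^ a S.≈ X S.^ b
  X^-cong-[] a b eq =
    S.trans (X^≈δ a) (S.trans (S.reflexive (cong δ eq)) (S.sym (X^≈δ b)))

  X^n≈1 : X S.^ suc m S.≈ S.1#
  X^n≈1 = X^-cong-[] (suc m) 0 ([]-cong-% (suc m) 0 (n%n≡0 (suc m)))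

  monomials-X : ∀ s → s S.≈ S∑.sum λ i → const (s i) S.* X S.^ toℕ i
  monomials-X s = S.trans (monomials s) (S∑.sum-cong-≋ λ i → S.*-congˡ {const (s i)}
    (S.trans (S.reflexive (cong δ (≡.sym ([]-toℕ i)))) (S.sym (X^≈δ (toℕ i)))))

  const-cong : ∀ {a b} → a ≈ b → const a S.≈ const b
  const-cong a≈b i = *-congʳ a≈b

  const-* : ∀ a b → const a S.* const b S.≈ const (a * b)
  const-* a b k = trans (const-⊛ a (const b) k) (sym (*-assoc a b _))

  const-^ : ∀ a j → const a S.^ j S.≈ const (a ^ j)
  const-^ a zero    i = sym (*-identityˡ _)
  const-^ a (suc j) = S.trans (S.*-congˡ {const a} (const-^ a j)) (const-* a (a ^ j))

  -- The power map is additive in characteristic two and multiplicative, so it is the identity once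
  -- it fixes the constants and X.
  periodic : ∀ j → (∀ a → a ^ (2 ℕ.^ j) ≈ a) → X S.^ (2 ℕ.^ j) S.≈ X →
    ∀ s → s S.^ (2 ℕ.^ j) S.≈ s
  periodic j aʲ≈a Xʲ≈X s = begin
    s S.^ Q                               ≈⟨ S.^-congˡ Q (monomials-X s) ⟩
    S∑.sum (λ i → term i) S.^ Q           ≈⟨ S₂.^2^-distrib-sum term j ⟩
    S∑.sum (λ i → term i S.^ Q)           ≈⟨ S∑.sum-cong-≋ fixed ⟩
    S∑.sum (λ i → term i)                 ≈⟨ monomials-X s ⟨
    s                                     ∎
    where
    open SetoidReasoning S.setoid
    Q = 2 ℕ.^ j
    term : Fin (suc m) → S.Carrier
    term i = const (s i) S.* X S.^ toℕ i

    fixed : ∀ i → term i S.^ Q S.≈ term i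
    fixed i = begin
      term i S.^ Q                                  ≈⟨ S.^-distrib-* (const (s i)) (X S.^ toℕ i) Q ⟩
      const (s i) S.^ Q S.* (X S.^ toℕ i) S.^ Q     ≈⟨ S.*-cong {const (s i) S.^ Q}
                                                         (S.trans (const-^ (s i) Q) (const-cong (aʲ≈a (s i))))
                                                         (S.trans (S.^-comm X (toℕ i) Q) (S.^-congˡ (toℕ i) Xʲ≈X)) ⟩
      term i                                        ∎

  -- Among n + 1 powers of two, two agree modulo n, so X^(2^i) = X^(2^j) with i < j. As 2k = n + 1,
  -- k inverts 2 modulo n and 2^i cancels, leaving the positive exponent j - i = `suc t`.
  X-fixed : ∀ {k} → suc (suc m) ≡ 2 ℕ.* k → ∃ λ t → X S.^ (2 ℕ.^ suc t) S.≈ X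
  X-fixed {k} 1+n≡2k with pigeonhole (ℕ.n<1+n (suc m)) (λ (i : Fin (suc (suc m))) → [ 2 ℕ.^ toℕ i ])
  ... | i , j , i<j , eq with ℕ.m≤n⇒∃[o]m+o≡n i<j
  ... | t , 1+i+t≡j = t , S.^2^-cancel k (toℕ i) (suc t)
    (S.trans (S.^-congʳ X (≡.sym 1+n≡2k)) (S.trans (S.*-congˡ {X} X^n≈1) (S.*-identityʳ X)))
    (S.trans (X^-cong-[] (2 ℕ.^ toℕ i) (2 ℕ.^ toℕ j) eq) (S.^-congʳ X (cong (2 ℕ.^_)
      (≡.trans (≡.sym 1+i+t≡j) (≡.sym (ℕ.+-suc (toℕ i) t))))))

  ⋆-cong : ∀ {s t} → s S.≈ t → s ⋆ S.≈ t ⋆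
  ⋆-cong s≈t k = s≈t (⊖ k)

  ⊖-zero : ⊖ zero ≡ zero
  ⊖-zero = ≡.trans (≡.sym (⊕-identityˡ (⊖ zero))) (⊖-inverseʳ zero)

  ⊖-involutive : ∀ i → ⊖ (⊖ i) ≡ i
  ⊖-involutive i = ≡.trans (cong (⊖_) (≡.sym (⊕-identityˡ (⊖ i))))
    (≡.trans (≡.sym (⊕-identityˡ _)) (⊝-⊝ zero i))

  ⋆-1 : S.1# ⋆ S.≈ S.1#
  ⋆-1 k = δ-⇔
    (λ 0≡⊖k → ≡.trans (≡.sym ⊖-zero) (≡.trans (cong ⊖_ 0≡⊖k) (⊖-involutive k)))
    (λ 0≡k → ≡.trans (≡.sym ⊖-zero) (cong ⊖_ 0≡k))

  ⋆-^ : ∀ s j → (s S.^ j) ⋆ S.≈ s ⋆ S.^ j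
  ⋆-^ s zero    = ⋆-1
  ⋆-^ s (suc j) = S.trans (⋆-homo-⊛ s (s S.^ j)) (S.*-congˡ {s ⋆} (⋆-^ s j))

  X*X⋆≈1 : X S.* X ⋆ S.≈ S.1#
  X*X⋆≈1 k = trans (X⊛ (X ⋆) k) (δ-⇔
    (λ 1≡ → ≡.sym (≡.trans (≡.sym (⊝-⊕ k [ 1 ])) (≡.trans (cong ((k ⊝ [ 1 ]) ⊕_) 1≡)
      (⊖-inverseʳ (k ⊝ [ 1 ])))))
    (λ { ≡.refl → ≡.sym (≡.trans (cong ⊖_ (⊕-identityˡ (⊖ [ 1 ]))) (⊖-involutive [ 1 ])) }))

  -- The Frobenius of K applied to coefficients. In contrast to squaring in S, it leaves the group
  -- elements in place.
  τ : S.Carrier → S.Carrier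
  τ s k = s k * s k

  τ-+ : ∀ s t → τ (s S.+ t) S.≈ τ s S.+ τ t
  τ-+ s t k = square-+ (s k) (t k)

  τ-* : ∀ s t → τ (s S.* t) S.≈ τ s S.* τ t
  τ-* s t k = trans (square-sum λ i → s i * t (k ⊝ i)) (sum-cong-≋ λ i →
    solve 2 (λ a b → a :* b :* (a :* b) := a :* a :* (b :* b)) refl (s i) (t (k ⊝ i)))
    where open Solver commutativeSemiring using (solve; _:*_; _:=_)

  τ-1 : τ S.1# S.≈ S.1#
  τ-1 k = helper
    where
    helper : δ zero k * δ zero k ≈ δ zero k
    helper with zero Fin.≟ k
    ... | yes _ = *-identityˡ 1#
    ... | no  _ = zeroˡ 0#

  τ-^ : ∀ s j → τ (s S.^ j) S.≈ τ s S.^ j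
  τ-^ s zero    = τ-1
  τ-^ s (suc j) = S.trans (τ-* s (s S.^ j)) (S.*-congˡ {τ s} (τ-^ s j))

  -- Over a field this says that all coefficients are 0 or 1. As an equation for the ring
  -- endomorphism `τ` it passes to sums, products and powers.
  Rational : S.Carrier → Set _
  Rational s = τ s S.≈ s

  rational-1 : Rational S.1#
  rational-1 = τ-1

  rational-+ : ∀ {s t} → Rational s → Rational t → Rational (s S.+ t)
  rational-+ {s} {t} rs rt = S.trans (τ-+ s t) (S.+-cong rs rt)

  rational-* : ∀ {s t} → Rational s → Rational t → Rational (s S.* t)
  rational-* {s} {t} rs rt = S.trans (τ-* s t) (S.*-cong {τ s} rs rt)

  rational-^ : ∀ {s} j → Rational s → Rational (s S.^ j)
  rational-^ {s} j rs = S.trans (τ-^ s j) (S.^-congˡ j rs)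

  rational-ι : ∀ (b : Vector Bool (suc m)) → Rational (ι ∘ b)
  rational-ι b k with b k
  ... | false = zeroˡ 0#
  ... | true  = *-identityˡ 1#

  -- Twisted s says that sₖ₊₁ = sₖ², so that s is the orbit of s₀.
  Twisted : S.Carrier → Set _
  Twisted s = X S.* τ s S.≈ s

  twisted-0 : Twisted S.0#
  twisted-0 = S.trans (S.*-congˡ {X} (λ k → zeroˡ 0#)) (S.zeroʳ X)

  twisted-+ : ∀ {s t} → Twisted s → Twisted t → Twisted (s S.+ t)
  twisted-+ {s} {t} ts tt = S.trans (S.*-congˡ {X} (τ-+ s t))
    (S.trans (S.distribˡ X (τ s) (τ t)) (S.+-cong ts tt))

  open Solver S.commutativeSemiring using (solve; _:*_; _:=_)

  twisted-* : ∀ {r s} → Rational r → Twisted s → Twisted (r S.* s)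
  twisted-* {r} {s} rr ts = begin
    X S.* τ (r S.* s)      ≈⟨ S.*-congˡ {X} (τ-* r s) ⟩
    X S.* (τ r S.* τ s)    ≈⟨ solve 3 (λ x a b → x :* (a :* b) := a :* (x :* b)) S.refl X (τ r) (τ s) ⟩
    τ r S.* (X S.* τ s)    ≈⟨ S.*-cong {τ r} rr ts ⟩
    r S.* s                ∎
    where open SetoidReasoning S.setoid

  -- The twist of s by X and that of s ⋆ by X ⋆ cancel, because X ⋆ is inverse to X.
  twisted-norm : ∀ {s} → Twisted s → Rational (s S.* s ⋆)
  twisted-norm {s} ts = begin
    τ (s S.* s ⋆)                          ≈⟨ τ-* s (s ⋆) ⟩
    τ s S.* τ s ⋆                          ≈⟨ S.*-identityˡ _ ⟨
    S.1# S.* (τ s S.* τ s ⋆)               ≈⟨ S.*-congʳ {τ s S.* τ s ⋆} X*X⋆≈1 ⟨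
    X S.* X ⋆ S.* (τ s S.* τ s ⋆)         ≈⟨ solve 4 (λ x y s t → x :* y :* (s :* t) := x :* s :* (y :* t))
                                                 S.refl X (X ⋆) (τ s) (τ s ⋆) ⟩
    X S.* τ s S.* (X ⋆ S.* τ s ⋆)         ≈⟨ S.*-congˡ {X S.* τ s} (⋆-homo-⊛ X (τ s)) ⟨
    X S.* τ s S.* (X S.* τ s) ⋆            ≈⟨ S.*-cong {X S.* τ s} ts (⋆-cong ts) ⟩
    s S.* s ⋆                              ∎
    where open SetoidReasoning S.setoid

  -- When t is a unit with inverse t^p, this is the quotient s / t. The twists contribute X * X^p,
  -- which is 1.
  twisted-quotient : ∀ {p s t} → X S.^ suc p S.≈ S.1# → Twisted s → Twisted t →
    Rational (s S.* t S.^ p)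
  twisted-quotient {p} {s} {t} X^[1+p]≈1 ts tt = begin
    τ (s S.* t S.^ p)                              ≈⟨ τ-* s (t S.^ p) ⟩
    τ s S.* τ (t S.^ p)                            ≈⟨ S.*-congˡ {τ s} (τ-^ t p) ⟩
    τ s S.* τ t S.^ p                              ≈⟨ S.*-identityˡ _ ⟨
    S.1# S.* (τ s S.* τ t S.^ p)                   ≈⟨ S.*-congʳ {τ s S.* τ t S.^ p} X^[1+p]≈1 ⟨
    X S.* X S.^ p S.* (τ s S.* τ t S.^ p)          ≈⟨ solve 4 (λ x y s t → x :* y :* (s :* t) := x :* s :* (y :* t))
                                                        S.refl X (X S.^ p) (τ s) (τ t S.^ p) ⟩
    X S.* τ s S.* (X S.^ p S.* τ t S.^ p)          ≈⟨ S.*-congˡ {X S.* τ s} (S.^-distrib-* X (τ t) p) ⟨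
    X S.* τ s S.* (X S.* τ t) S.^ p                ≈⟨ S.*-cong {X S.* τ s} ts (S.^-congˡ p tt) ⟩
    s S.* t S.^ p                                  ∎
    where open SetoidReasoning S.setoid

  orbit : Carrier → S.Carrier
  orbit = Extension.conjugates K (suc m)

  twisted⇒orbit : ∀ {s} → Twisted s → s S.≈ orbit (s zero)
  twisted⇒orbit {s} ts i = trans (reflexive (cong s (≡.sym ([]-toℕ i)))) (go (toℕ i))
    where
    go : ∀ a → s [ a ] ≈ s zero ^ (2 ℕ.^ a)
    go zero    = sym (*-identityʳ (s zero))
    go (suc a) = begin
      s [ suc a ]                                    ≈⟨ ts [ suc a ] ⟨
      (X S.* τ s) [ suc a ]                          ≈⟨ X⊛ (τ s) [ suc a ] ⟩
      τ s ([ suc a ] ⊝ [ 1 ])                        ≈⟨ reflexive (cong (τ s) pred) ⟩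
      τ s [ a ]                                      ≈⟨ *-cong (go a) (go a) ⟩
      s zero ^ (2 ℕ.^ a) * s zero ^ (2 ℕ.^ a)        ≈⟨ ^2^suc (s zero) a ⟨
      s zero ^ (2 ℕ.^ suc a)                         ∎
      where
      open SetoidReasoning setoid
      pred : [ suc a ] ⊝ [ 1 ] ≡ [ a ]
      pred = ≡.trans (cong (_⊝ [ 1 ]) (≡.trans (≡.sym ([]-+ 1 a)) (⊕-comm [ 1 ] [ a ])))
        (⊕-⊝ [ a ] [ 1 ])

-- Frobenius orbits and traces.

module NormalElements (K : CommutativeRing c ℓ) (m : ℕ)
  (isField : IsFieldOfOrder K (2 ℕ.^ suc m)) where
  open CommutativeRing K hiding (zero)
  open Exp commutativeSemiring
  open SemiringSum semiring
  open IsFieldOfOrder isField using (1≉0)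
  open BinaryField K {suc m} isField
  open CyclicAlgebra K 1+1≈0 m public
  open Extension K

  private
    n = suc m

  ^2^-[] : ∀ x a → x ^ (2 ℕ.^ toℕ [ a ]) ≈ x ^ (2 ℕ.^ a)
  ^2^-[] x a = begin
    x ^ (2 ℕ.^ toℕ [ a ])                  ≈⟨ ^-congʳ x (cong (2 ℕ.^_) (toℕ-[] a)) ⟩
    x ^ (2 ℕ.^ r)                          ≈⟨ Powers.^-fixed K (2 ℕ.^ n) (x^q≈x _) t ⟨
    (x ^ (2 ℕ.^ r)) ^ ((2 ℕ.^ n) ℕ.^ t)    ≈⟨ ^-assocʳ x (2 ℕ.^ r) ((2 ℕ.^ n) ℕ.^ t) ⟩
    x ^ (2 ℕ.^ r ℕ.* (2 ℕ.^ n) ℕ.^ t)      ≈⟨ ^-congʳ x exponent ⟩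
    x ^ (2 ℕ.^ a)                          ∎
    where
    open SetoidReasoning setoid
    r = a % n
    t = a / n
    exponent : 2 ℕ.^ r ℕ.* (2 ℕ.^ n) ℕ.^ t ≡ 2 ℕ.^ a
    exponent = ≡.trans (cong (2 ℕ.^ r ℕ.*_) (≡.trans (ℕ.^-*-assoc 2 n t) (cong (2 ℕ.^_) (ℕ.*-comm n t))))
      (≡.trans (≡.sym (ℕ.^-distribˡ-+-* 2 r (t ℕ.* n))) (cong (2 ℕ.^_) (≡.sym (m≡m%n+[m/n]*n a n))))

  -- Squaring the last conjugate wraps around to the first one because α^(2^n) = α.
  orbit-twisted : ∀ α → Twisted (orbit α)
  orbit-twisted α k = begin
    (X S.* τ (orbit α)) k                  ≈⟨ X⊛ (τ (orbit α)) k ⟩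
    α ^ (2 ℕ.^ j) * α ^ (2 ℕ.^ j)          ≈⟨ ^2^suc α j ⟨
    α ^ (2 ℕ.^ suc j)                      ≈⟨ ^2^-[] α (suc j) ⟨
    α ^ (2 ℕ.^ toℕ [ suc j ])              ≈⟨ ^-congʳ α (cong (λ i → 2 ℕ.^ toℕ i) succ) ⟩
    orbit α k                              ∎
    where
    open SetoidReasoning setoid
    j = toℕ (k ⊝ [ 1 ])
    succ : [ suc j ] ≡ k
    succ = ≡.trans (≡.sym ([]-+ 1 j)) (≡.trans (cong ([ 1 ] ⊕_) ([]-toℕ (k ⊝ [ 1 ])))
      (≡.trans (⊕-comm [ 1 ] (k ⊝ [ 1 ])) (⊝-⊕ k [ 1 ])))

  orbit-cong : ∀ {α β} → α ≈ β → orbit α S.≈ orbit β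
  orbit-cong α≈β k = ^-congˡ (2 ℕ.^ toℕ k) α≈β

  zero⊝ : ∀ i → zero ⊝ i ≡ ⊖ i
  zero⊝ i = ⊕-identityˡ (⊖ i)

  coefficient-zero : ∀ s t → (s S.* t) zero ≈ sum λ i → s (⊖ i) * t i
  coefficient-zero s t = trans (∑-⊖ λ i → s i * t (zero ⊝ i)) (sum-cong-≋ {n} λ i →
    *-congˡ {s (⊖ i)} (reflexive (cong t (≡.trans (zero⊝ (⊖ i)) (⊖-involutive i)))))

  -- This carries linear algebra over the prime field into the ring: the product on the right is
  -- twisted, so its coefficient at 0 determines all of it.
  linearCombination-orbit : ∀ b α →
    linearCombination b (orbit α) ≈ ((ι ∘ b) ⋆ S.* orbit α) zero
  linearCombination-orbit b α = sym (trans (coefficient-zero ((ι ∘ b) ⋆) (orbit α))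
    (sum-cong-≋ {n} λ i → *-congʳ {orbit α i} (reflexive (cong (ι ∘ b) (⊖-involutive i)))))

  -- The coefficient at k is the sum of α^(2^i) α^(2^(i-k)) over residues i. Replacing i by i + k
  -- makes each term a conjugate of α α^(2^k).
  orbit-norm : ∀ α k → (orbit α S.* orbit α ⋆) k ≈ Tr n (α * α ^ (2 ℕ.^ toℕ k))
  orbit-norm α k = trans (∑-shift k λ i → orbit α i * orbit α (⊖ (k ⊝ i))) (sum-cong-≋ term)
    where
    open SetoidReasoning setoid
    shift : ∀ i → ⊖ (k ⊝ (i ⊕ k)) ≡ i
    shift i = ≡.trans (cong ⊖_ (≡.trans (⊝-swap k i k)
      (≡.trans (cong (_⊝ i) (⊖-inverseʳ k)) (zero⊝ i)))) (⊖-involutive i)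

    term : ∀ i → orbit α (i ⊕ k) * orbit α (⊖ (k ⊝ (i ⊕ k))) ≈
      (α * α ^ (2 ℕ.^ toℕ k)) ^ (2 ℕ.^ toℕ i)
    term i = begin
      orbit α (i ⊕ k) * orbit α (⊖ (k ⊝ (i ⊕ k)))
        ≈⟨ *-cong (^2^-[] α (toℕ i ℕ.+ toℕ k)) (reflexive (cong (orbit α) (shift i))) ⟩
      α ^ (2 ℕ.^ (toℕ i ℕ.+ toℕ k)) * orbit α i
        ≈⟨ *-comm _ _ ⟩
      orbit α i * α ^ (2 ℕ.^ (toℕ i ℕ.+ toℕ k))
        ≈⟨ *-congˡ (^-congʳ α (≡.trans (cong (2 ℕ.^_) (ℕ.+-comm (toℕ i) (toℕ k)))
             (ℕ.^-distribˡ-+-* 2 (toℕ k) (toℕ i)))) ⟩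
      orbit α i * α ^ (2 ℕ.^ toℕ k ℕ.* 2 ℕ.^ toℕ i)
        ≈⟨ *-congˡ (^-assocʳ α (2 ℕ.^ toℕ k) (2 ℕ.^ toℕ i)) ⟨
      α ^ (2 ℕ.^ toℕ i) * (α ^ (2 ℕ.^ toℕ k)) ^ (2 ℕ.^ toℕ i)
        ≈⟨ ^-distrib-* α (α ^ (2 ℕ.^ toℕ k)) (2 ℕ.^ toℕ i) ⟨
      (α * α ^ (2 ℕ.^ toℕ k)) ^ (2 ℕ.^ toℕ i) ∎

  ι-injective : ∀ {a b} → ι a ≈ ι b → a ≡ b
  ι-injective {false} {false} _  = ≡.refl
  ι-injective {false} {true}  eq = ⊥-elim (1≉0 (sym eq))
  ι-injective {true}  {false} eq = ⊥-elim (1≉0 eq)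
  ι-injective {true}  {true}  _  = ≡.refl

  idempotent⇒ι : ∀ {x} → x * x ≈ x → ∃ λ b → x ≈ ι b
  idempotent⇒ι {x} xx≈x with x ≟ 0#
  ... | yes x≈0 = false , x≈0
  ... | no  x≉0 = true , x+y≈0⇒x≈y (integral (begin
    x * (x + 1#)       ≈⟨ distribˡ x x 1# ⟩
    x * x + x * 1#     ≈⟨ +-cong xx≈x (*-identityʳ x) ⟩
    x + x              ≈⟨ x+x≈0 x ⟩
    0#                 ∎) x≉0)
    where open SetoidReasoning setoid

  rational⇒ι : ∀ {s} → Rational s → ∃ λ b → s S.≈ ι ∘ b
  rational⇒ι rs = (λ k → proj₁ (idempotent⇒ι (rs k))) , λ k → proj₂ (idempotent⇒ι (rs k))

  -- The coefficient at 0 of t times the orbit of β is a linearized polynomial in β with the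
  -- reflected coefficients of t. It vanishes on all of K and has only n terms.
  annihilates-orbits⇒0 : ∀ {t} → (∀ β → t S.* orbit β S.≈ S.0#) → t S.≈ S.0#
  annihilates-orbits⇒0 {t} kills i = trans (reflexive (cong t (≡.sym (⊖-involutive i))))
    (linearized-injective ℕ.≤-refl (t ⋆)
      (λ β → trans (sym (coefficient-zero t (orbit β))) (kills β zero)) (⊖ i))

  odd⇒half : ¬ (2 ∣ n) → ∃ λ k → suc n ≡ 2 ℕ.* k
  odd⇒half odd with 2∣n⊎2∣1+n n
  ... | inj₁ 2∣n            = ⊥-elim (odd 2∣n)
  ... | inj₂ (divides k eq) = k , ≡.trans eq (ℕ.*-comm k 2)

  -- The same exponent is written in two ways: as 2 + p to read off inverses x^p, and as 2^(1+h) to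
  -- read off square roots x^(2^h).
  record FrobeniusPeriod : Set (c ⊔ ℓ) where
    field
      h p         : ℕ
      2+p≡2^[1+h] : 2 ℕ.+ p ≡ 2 ℕ.^ suc h
      periodic-S  : ∀ s → s S.^ (2 ℕ.^ suc h) S.≈ s

  -- The exponent n * `suc t` is a common multiple of n, after which Frobenius is trivial on K, and
  -- of `suc t`, after which it fixes X.
  frobeniusPeriod : ¬ (2 ∣ n) → FrobeniusPeriod
  frobeniusPeriod odd = fromPeriods (X-fixed {proj₁ (odd⇒half odd)} (proj₂ (odd⇒half odd)))
    where
    fromExponent : ∀ t → X S.^ (2 ℕ.^ suc t) S.≈ X →
      (∃ λ p → 2 ℕ.+ p ≡ 2 ℕ.^ (n ℕ.* suc t)) → FrobeniusPeriod
    fromExponent t X-periodic (p , 2+p≡) = record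
      -- Chosen so that `suc h` computes to n * `suc t`.
      { h           = t ℕ.+ m ℕ.* suc t
      ; p           = p
      ; 2+p≡2^[1+h] = 2+p≡
      ; periodic-S  = periodic (n ℕ.* suc t)
          (λ a → trans (^-congʳ a (≡.sym (ℕ.^-*-assoc 2 n (suc t))))
            (Powers.^-fixed K (2 ℕ.^ n) (x^q≈x a) (suc t)))
          (S.trans (S.^-congʳ X (≡.trans (cong (2 ℕ.^_) (ℕ.*-comm n (suc t)))
              (≡.sym (ℕ.^-*-assoc 2 (suc t) n))))
            (S.^-fixed (2 ℕ.^ suc t) X-periodic n))
      }

    fromPeriods : (∃ λ t → X S.^ (2 ℕ.^ suc t) S.≈ X) → FrobeniusPeriod
    fromPeriods (t , X-periodic) = fromExponent t X-periodic
      (ℕ.m≤n⇒∃[o]m+o≡n (ℕ.^-monoʳ-≤ 2 {1} {n ℕ.* suc t} (ℕ.s≤s ℕ.z≤n)))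

-- Normal elements as units, and their norms.

module Norms (K : CommutativeRing c ℓ) (m : ℕ)
  (isField : IsFieldOfOrder K (2 ℕ.^ suc m))
  (period : NormalElements.FrobeniusPeriod K m isField) where
  open CommutativeRing K hiding (zero)
  open IsFieldOfOrder isField using (enumeration)
  open Inverse enumeration using (to; from; strictlyInverseʳ)
  open BinaryField K {suc m} isField
  open Extension K
  open NormalElements K m isField

  private
    n = suc m

  open FrobeniusPeriod period public

  open PeriodicRing groupRing S-1+1≈0 p
    (λ s → S.trans (S.^-congʳ s 2+p≡2^[1+h]) (periodic-S s)) public

  X-support : X S.^ suc p S.≈ S.1#
  X-support = support-unit {X} {X S.^ m} X^n≈1

  -- Being a power, this root stays symmetric and rational when its argument is.
  √ : S.Carrier → S.Carrier
  √ s = s S.^ (2 ℕ.^ h)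

  √-square : ∀ s → √ s S.* √ s S.≈ s
  √-square s = S.trans (S.sym (S₂.^2^suc s h)) (periodic-S s)

  -- The support is s * s^p, a twisted element divided by itself.
  support-rational : ∀ {s} → Twisted s → Rational (support s)
  support-rational {s} ts = twisted-quotient {p} {s} {s} X-support ts ts

  twisted-join : ∀ {s t} → Twisted s → Twisted t → Twisted (join s t)
  twisted-join {s} {t} ts tt = twisted-+ {s} {(S.1# S.+ support s) S.* t} ts
    (twisted-* {S.1# S.+ support s} {t} (rational-+ {S.1#} {support s} rational-1 (support-rational ts)) tt)

  -- The orbit of β is a unit exactly when β is normal: see normal⇒unit and
  -- unit⇒normal.
  normalBasisTheorem : ∃ λ β → support (orbit β) S.≈ S.1#
  normalBasisTheorem = fromGenerator (commonGenerator Twisted twisted-0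
      (λ {s} {t} → twisted-join {s} {t}) (orbit ∘ from) (orbit-twisted ∘ from))
    where
    fromGenerator : (∃ λ g → Twisted g ×
        (∀ t → t S.* g S.≈ S.0# → ∀ i → t S.* orbit (from i) S.≈ S.0#)) →
      ∃ λ β → support (orbit β) S.≈ S.1#
    -- The element 1 + `support g` kills g, hence every orbit, hence is 0. Being twisted, g is the
    -- orbit of its coefficient at 0.
    fromGenerator (g , tg , annihilates) = g zero , S.trans (support-cong (S.sym (twisted⇒orbit tg)))
      (S.sym (S₂.x+y≈0⇒x≈y {S.1#} {support g} (annihilates-orbits⇒0 λ β →
        S.trans (S.*-congˡ {S.1# S.+ support g} (orbit-cong (sym (strictlyInverseʳ β))))
          (annihilates (S.1# S.+ support g) ([1+support]*x≈0 g) (to β)))))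

  annihilator-trivial : ∀ {α} → IsNormal n α → ∀ {r} → Rational r →
    r S.* orbit α S.≈ S.0# → r S.≈ S.0#
  annihilator-trivial {α} normal {r} r-rational rα≈0 = vanish (rational⇒ι r-rational)
    where
    vanish : (∃ λ b → r S.≈ ι ∘ b) → r S.≈ S.0#
    vanish (b , r≈b) k = trans (r≈b k) (reflexive (cong ι b≡false))
      where
      b⋆ : Vector Bool n
      b⋆ i = b (⊖ i)

      b⋆-combination : linearCombination b⋆ (orbit α) ≈ 0#
      b⋆-combination = trans (linearCombination-orbit b⋆ α)
        (trans (S.*-congʳ {orbit α} {(ι ∘ b⋆) ⋆} {r}
          (λ i → trans (reflexive (cong (ι ∘ b) (⊖-involutive i))) (sym (r≈b i))) zero)
          (rα≈0 zero))

      b≡false : b k ≡ false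
      b≡false = ≡.trans (cong b (≡.sym (⊖-involutive k)))
        (IsBasis.independent normal b⋆ b⋆-combination (⊖ k))

  -- 1 + `support (orbit α)` has coefficients in the prime field and kills the orbit, so it encodes
  -- a linear relation between the conjugates and must be 0.
  normal⇒unit : ∀ {α} → IsNormal n α → support (orbit α) S.≈ S.1#
  normal⇒unit {α} normal = S.sym (S₂.x+y≈0⇒x≈y {S.1#} {support (orbit α)}
    (annihilator-trivial normal {S.1# S.+ support (orbit α)}
      (rational-+ {S.1#} {support (orbit α)} rational-1
        (support-rational {orbit α} (orbit-twisted α)))
      ([1+support]*x≈0 (orbit α))))

  unit⇒normal : ∀ {α} → support (orbit α) S.≈ S.1# → IsNormal n α
  unit⇒normal {α} unit = record { independent = independent ; spanning = spanning }
    where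
    open SetoidReasoning S.setoid
    B = orbit α
    independent : ∀ b → linearCombination b B ≈ 0# → ∀ i → b i ≡ false
    independent b lc≈0 i = ι-injective (trans (reflexive (cong (ι ∘ b) (≡.sym (⊖-involutive i)))) (r≈0 (⊖ i)))
      where
      r = (ι ∘ b) ⋆
      -- The hypothesis speaks only of the coefficient at 0, but the product is twisted and so is
      -- the orbit of that coefficient.
      rB≈0 : r S.* B S.≈ S.0#
      rB≈0 = begin
        r S.* B                     ≈⟨ twisted⇒orbit (twisted-* {r} {B} (rational-ι (b ∘ ⊖_)) (orbit-twisted α)) ⟩
        orbit ((r S.* B) zero)      ≈⟨ orbit-cong (trans (sym (linearCombination-orbit b α)) lc≈0) ⟩
        orbit 0#                    ≈⟨ (λ k → 0^2^ (toℕ k)) ⟩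
        S.0#                        ∎
      r≈0 : r S.≈ S.0#
      r≈0 = begin
        r                           ≈⟨ S.*-identityʳ r ⟨
        r S.* S.1#                  ≈⟨ S.*-congˡ {r} unit ⟨
        r S.* (B S.* B S.^ p)       ≈⟨ S.*-assoc r B (B S.^ p) ⟨
        r S.* B S.* B S.^ p         ≈⟨ S.*-congʳ {B S.^ p} rB≈0 ⟩
        S.0# S.* B S.^ p            ≈⟨ S.zeroˡ (B S.^ p) ⟩
        S.0#                        ∎

    -- The coordinates of x are the coefficients of the orbit of x divided by that of α, in
    -- reflected order.
    spanning : ∀ x → ∃ λ b → linearCombination b B ≈ x
    spanning x = fromQuotient (rational⇒ι
        (twisted-quotient {p} {orbit x} {B} X-support (orbit-twisted x) (orbit-twisted α)))
      where
      fromQuotient : (∃ λ b → orbit x S.* B S.^ p S.≈ ι ∘ b) →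
        ∃ λ b → linearCombination b B ≈ x
      fromQuotient (b , r≈b) = b⋆ , trans (linearCombination-orbit b⋆ α)
        (trans (product zero) (*-identityʳ x))
        where
        b⋆ : Vector Bool n
        b⋆ i = b (⊖ i)

        product : (ι ∘ b⋆) ⋆ S.* B S.≈ orbit x
        product = begin
          (ι ∘ b⋆) ⋆ S.* B                  ≈⟨ S.*-congʳ {B} (λ i → trans
                                                 (reflexive (cong (ι ∘ b) (⊖-involutive i))) (sym (r≈b i))) ⟩
          orbit x S.* B S.^ p S.* B         ≈⟨ S.*-assoc (orbit x) (B S.^ p) B ⟩
          orbit x S.* (B S.^ p S.* B)       ≈⟨ S.*-congˡ {orbit x} (S.trans (S.*-comm (B S.^ p) B) unit) ⟩
          orbit x S.* S.1#                  ≈⟨ S.*-identityʳ (orbit x) ⟩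
          orbit x                           ∎

  norm-symmetric : ∀ s → (s S.* s ⋆) ⋆ S.≈ s S.* s ⋆
  norm-symmetric s = S.trans (⋆-homo-⊛ s (s ⋆))
    (S.trans (S.*-congˡ {s ⋆} (⋆-involutive s)) (S.*-comm (s ⋆) s))

  norm-unit : ∀ {s} → support s S.≈ S.1# → support (s S.* s ⋆) S.≈ S.1#
  norm-unit {s} unit = begin
    support (s S.* s ⋆)                  ≈⟨ S.^-distrib-* s (s ⋆) (suc p) ⟩
    support s S.* support (s ⋆)          ≈⟨ S.*-cong {support s} unit
                                              (S.trans (S.sym (⋆-^ s (suc p))) (S.trans (⋆-cong unit) ⋆-1)) ⟩
    S.1# S.* S.1#                        ≈⟨ S.*-identityʳ S.1# ⟩
    S.1#                                 ∎
    where open SetoidReasoning S.setoid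

  symmetric-unit⇒norm : ∀ {f} → Rational f → f ⋆ S.≈ f → support f S.≈ S.1# →
    ∃ λ α → support (orbit α) S.≈ S.1# × (orbit α S.* orbit α ⋆) S.≈ f
  symmetric-unit⇒norm {f} rf sf uf = B zero , S.trans (support-cong orbit≈B) uB ,
    S.trans (S.*-cong {orbit (B zero)} orbit≈B (⋆-cong orbit≈B)) norm
    where
    open SetoidReasoning S.setoid
    open Solver S.commutativeSemiring using (solve; _:*_; _:=_)
    c₀ N q s B : S.Carrier
    c₀ = orbit (proj₁ normalBasisTheorem)
    N = c₀ S.* c₀ ⋆
    -- `N ^ p` inverts the unit `N`, so this is f divided by the norm of a known normal element;
    -- rationality and symmetry pass to it from f and `N`.
    q = f S.* N S.^ p
    s = √ q
    B = s S.* c₀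

    uN : support N S.≈ S.1#
    uN = norm-unit (proj₂ normalBasisTheorem)

    rq : Rational q
    rq = rational-* {f} {N S.^ p} rf (rational-^ {N} p (twisted-norm {c₀} (orbit-twisted _)))

    sq : q ⋆ S.≈ q
    sq = S.trans (⋆-homo-⊛ f (N S.^ p)) (S.*-cong {f ⋆} sf
      (S.trans (⋆-^ N p) (S.^-congˡ p (norm-symmetric c₀))))

    ss : s ⋆ S.≈ s
    ss = S.trans (⋆-^ q (2 ℕ.^ h)) (S.^-congˡ (2 ℕ.^ h) sq)

    tB : Twisted B
    tB = twisted-* {s} {c₀} (rational-^ {q} (2 ℕ.^ h) rq) (orbit-twisted _)

    orbit≈B : orbit (B zero) S.≈ B
    orbit≈B = S.sym (twisted⇒orbit tB)

    norm : B S.* B ⋆ S.≈ f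
    norm = begin
      B S.* B ⋆                      ≈⟨ S.*-congˡ {B} (⋆-homo-⊛ s c₀) ⟩
      B S.* (s ⋆ S.* c₀ ⋆)           ≈⟨ S.*-congˡ {B} (S.*-congʳ {c₀ ⋆} ss) ⟩
      s S.* c₀ S.* (s S.* c₀ ⋆)      ≈⟨ solve 3 (λ s c d → s :* c :* (s :* d) := s :* s :* (c :* d)) S.refl s c₀ (c₀ ⋆) ⟩
      s S.* s S.* N                  ≈⟨ S.*-congʳ {N} (√-square q) ⟩
      f S.* N S.^ p S.* N            ≈⟨ solve 3 (λ f x y → f :* x :* y := f :* (y :* x)) S.refl f (N S.^ p) N ⟩
      f S.* support N                ≈⟨ S.*-congˡ {f} uN ⟩
      f S.* S.1#                     ≈⟨ S.*-identityʳ f ⟩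
      f                              ∎

    uB : support B S.≈ S.1#
    -- Since B B⋆ = f is a unit with inverse f^p, the inverse of B is B⋆ f^p.
    uB = support-unit {B} {B ⋆ S.* f S.^ p} (S.trans (S.sym (S.*-assoc B (B ⋆) (f S.^ p)))
      (S.trans (S.*-congʳ {f S.^ p} norm) uf))

-- From units of the group ring to symmetric polynomials coprime to xⁿ - 1.

coeff-fromVector : ∀ {n} (v : Vector Bool n) i → 𝔽₂[X].coeff (𝔽₂[X].fromVector v) (toℕ i) ≡ v i
coeff-fromVector v zero    = ≡.refl
coeff-fromVector v (suc i) = coeff-fromVector (v ∘ suc) i

module Characterization (K : CommutativeRing c ℓ) (m : ℕ)
  (isField : IsFieldOfOrder K (2 ℕ.^ suc m))
  (period : NormalElements.FrobeniusPeriod K m isField) where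
  open CommutativeRing K hiding (zero)
  open NormalElements K m isField
  open Norms K m isField period
  open Extension K
  open 𝔽₂[X] using (Poly; fromVector; xⁿ-1; Symmetric)
  open 𝔽₂-Polynomials
  open Extension groupRing using () renaming (ι to ιₛ)

  private
    n = suc m
    module Eval = Evaluation groupRing S-1+1≈0 X

  const-ι : ∀ b → const (ι b) S.≈ ιₛ b
  const-ι false i = zeroˡ _
  const-ι true  i = *-identityˡ _

  eval-fromVector≈ι : ∀ (a : Vector Bool n) → Eval.eval (fromVector a) S.≈ ι ∘ a
  eval-fromVector≈ι a = begin
    Eval.eval (fromVector a)                              ≈⟨ Eval.eval-fromVector a ⟩
    S∑.sum (λ i → ιₛ (a i) S.* X S.^ toℕ i)              ≈⟨ S∑.sum-cong-≋ (λ i →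
                                                               S.*-congʳ {X S.^ toℕ i} (const-ι (a i))) ⟨
    S∑.sum (λ i → const (ι (a i)) S.* X S.^ toℕ i)       ≈⟨ monomials-X (ι ∘ a) ⟨
    ι ∘ a                                                 ∎
    where open SetoidReasoning S.setoid

  -- Evaluation at X kills xⁿ - 1, so q and its remainder have the same value. The coefficients of
  -- that value are those of the remainder, which therefore vanishes.
  eval-kernel : ∀ q → Eval.eval q S.≈ S.0# → ∃ λ h → q ℙ.≈ h ℙ.* xⁿ-1 n
  eval-kernel q q≈0 = fromRemainder (divMod-xⁿ-1 m q)
    where
    M = xⁿ-1 n
    fromRemainder : (∃ λ h → ∃ λ v → q ℙ.≈ h ℙ.* M ℙ.+ fromVector {n} v) →
      ∃ λ h → q ℙ.≈ h ℙ.* M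
    fromRemainder (h , v , q≈) = h , ℙ.trans q≈ (ℙ.trans (ℙ.+-congˡ {h ℙ.* M} v≈0) (ℙ.+-identityʳ (h ℙ.* M)))
      where
      ιv≈0 : ι ∘ v S.≈ S.0#
      ιv≈0 = begin
        ι ∘ v                                               ≈⟨ eval-fromVector≈ι v ⟨
        Eval.eval (fromVector v)                            ≈⟨ S.+-identityˡ _ ⟨
        S.0# S.+ Eval.eval (fromVector v)                   ≈⟨ S.+-congʳ {Eval.eval (fromVector v)}
                                                                 (S.trans (Eval.eval-* h M)
                                                                   (S.trans (S.*-congˡ {Eval.eval h} (Eval.eval-xⁿ-1 n X^n≈1))
                                                                     (S.zeroʳ (Eval.eval h)))) ⟨
        Eval.eval (h ℙ.* M) S.+ Eval.eval (fromVector v)    ≈⟨ Eval.eval-+ (h ℙ.* M) (fromVector v) ⟨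
        Eval.eval (h ℙ.* M ℙ.+ fromVector v)                ≈⟨ Eval.eval-cong q≈ ⟨
        Eval.eval q                                         ≈⟨ q≈0 ⟩
        S.0#                                                ∎
        where open SetoidReasoning S.setoid

      v≈0 : fromVector v ℙ.≈ []
      v≈0 = fromVector≈0 v (λ i → ι-injective (ιv≈0 i))

  CoprimeToXⁿ-1 : Vector Bool n → Set
  CoprimeToXⁿ-1 a = IsGCD 𝔽₂[X].*-rawMagma (fromVector a) (xⁿ-1 n) 𝔽₂[X].1#

  -- The inverse, a power of a rational element, is rational and lifts to a polynomial g. Then f g +
  -- 1 is a multiple of xⁿ - 1, which is a Bézout identity.
  unit⇒coprime : ∀ a → support (ι ∘ a) S.≈ S.1# → CoprimeToXⁿ-1 a
  unit⇒coprime a unit = fromInverse (rational⇒ι (rational-^ {ι ∘ a} p (rational-ι a)))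
    where
    f M : Poly
    f = fromVector a
    M = xⁿ-1 n
    fromInverse : (∃ λ b → (ι ∘ a) S.^ p S.≈ ι ∘ b) → CoprimeToXⁿ-1 a
    fromInverse (b , inverse≈b) = fromKernel (eval-kernel (f ℙ.* g ℙ.+ ℙ.1#) fg+1≈0)
      where
      g : Poly
      g = fromVector b

      fg+1≈0 : Eval.eval (f ℙ.* g ℙ.+ ℙ.1#) S.≈ S.0#
      fg+1≈0 = begin
        Eval.eval (f ℙ.* g ℙ.+ ℙ.1#)             ≈⟨ Eval.eval-+ (f ℙ.* g) ℙ.1# ⟩
        Eval.eval (f ℙ.* g) S.+ Eval.eval ℙ.1#   ≈⟨ S.+-cong (Eval.eval-* f g) Eval.eval-1 ⟩
        Eval.eval f S.* Eval.eval g S.+ S.1#     ≈⟨ S.+-congʳ {S.1#} (S.*-cong {Eval.eval f} (eval-fromVector≈ι a)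
                                                      (S.trans (eval-fromVector≈ι b) (S.sym inverse≈b))) ⟩
        support (ι ∘ a) S.+ S.1#                 ≈⟨ S.+-congʳ {S.1#} unit ⟩
        S.1# S.+ S.1#                            ≈⟨ S-1+1≈0 ⟩
        S.0#                                     ∎
        where open SetoidReasoning S.setoid

      fromKernel : (∃ λ h → f ℙ.* g ℙ.+ ℙ.1# ℙ.≈ h ℙ.* M) → CoprimeToXⁿ-1 a
      fromKernel (h , fg+1≈hM) = record
        { d∣x      = f ,ₚ ℙ.*-identityʳ f
        ; d∣y      = M ,ₚ ℙ.*-identityʳ M
        ; greatest = greatest
        }
        where
        greatest : ∀ {e} → e ∣ₚ f → e ∣ₚ M → e ∣ₚ ℙ.1#
        greatest {e} (u ,ₚ ue≈f) (w ,ₚ we≈M) = g ℙ.* u ℙ.+ h ℙ.* w ,ₚ (begin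
          (g ℙ.* u ℙ.+ h ℙ.* w) ℙ.* e                ≈⟨ solve 5 (λ g u h w e → (g :* u :+ h :* w) :* e :=
                                                          (u :* e) :* g :+ h :* (w :* e)) ℙ.refl g u h w e ⟩
          u ℙ.* e ℙ.* g ℙ.+ h ℙ.* (w ℙ.* e)          ≈⟨ ℙ.+-cong {u ℙ.* e ℙ.* g} (ℙ.*-congʳ {g} ue≈f) (ℙ.*-congˡ {h} we≈M) ⟩
          f ℙ.* g ℙ.+ h ℙ.* M                        ≈⟨ ℙ.+-congˡ {f ℙ.* g} fg+1≈hM ⟨
          f ℙ.* g ℙ.+ (f ℙ.* g ℙ.+ ℙ.1#)             ≈⟨ ℙ₂.x+[x+y]≈y (f ℙ.* g) ℙ.1# ⟩
          ℙ.1#                                       ∎)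
          where
          open SetoidReasoning ℙ.setoid
          open Solver ℙ.commutativeSemiring using (solve; _:+_; _:*_; _:=_)

  -- In S the Bézout combination loses its term in xⁿ - 1 and reads U F = X^k D with D a unit. The
  -- factor X^k is cancelled by (X^m)^k, as X^(m+1) = 1.
  coprime⇒unit : ∀ a → CoprimeToXⁿ-1 a → support (ι ∘ a) S.≈ S.1#
  coprime⇒unit a coprime = fromCombination (IsGCD.greatest coprime d∣p d∣q)
    where
    f M : Poly
    f = fromVector a
    M = xⁿ-1 n
    open Bézout (bézout f M)

    fromCombination : d ∣ₚ ℙ.1# → support (ι ∘ a) S.≈ S.1#
    fromCombination (w ,ₚ wd≈1) = support-unit {ι ∘ a} {W S.* U S.* (X S.^ m) S.^ k} (begin
      (ι ∘ a) S.* (W S.* U S.* (X S.^ m) S.^ k)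
        ≈⟨ S.*-congʳ {W S.* U S.* (X S.^ m) S.^ k} (eval-fromVector≈ι a) ⟨
      F S.* (W S.* U S.* (X S.^ m) S.^ k)
        ≈⟨ solve 4 (λ f w u x → f :* (w :* u :* x) := w :* (u :* f) :* x) S.refl F W U ((X S.^ m) S.^ k) ⟩
      W S.* (U S.* F) S.* (X S.^ m) S.^ k
        ≈⟨ S.*-congʳ {(X S.^ m) S.^ k} (S.*-congˡ {W} UF≈) ⟩
      W S.* (X S.^ k S.* D) S.* (X S.^ m) S.^ k
        ≈⟨ solve 4 (λ w x d y → w :* (x :* d) :* y := w :* d :* (x :* y)) S.refl W (X S.^ k) D ((X S.^ m) S.^ k) ⟩
      W S.* D S.* (X S.^ k S.* (X S.^ m) S.^ k)
        ≈⟨ S.*-cong {W S.* D} WD≈1 (S.trans (S.sym (S.^-distrib-* X (X S.^ m) k))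
             (S.trans (S.^-congˡ k X^n≈1) (S.1^ k))) ⟩
      S.1# S.* S.1#
        ≈⟨ S.*-identityʳ S.1# ⟩
      S.1# ∎)
      where
      open SetoidReasoning S.setoid
      open Solver S.commutativeSemiring using (solve; _:*_; _:=_)
      F D U W : S.Carrier
      F = Eval.eval f
      D = Eval.eval d
      U = Eval.eval u
      W = Eval.eval w

      WD≈1 : W S.* D S.≈ S.1#
      WD≈1 = S.trans (S.sym (Eval.eval-* w d)) (S.trans (Eval.eval-cong wd≈1) Eval.eval-1)

      UF≈ : U S.* F S.≈ X S.^ k S.* D
      UF≈ = begin
        U S.* F                                     ≈⟨ S.+-identityʳ _ ⟨
        U S.* F S.+ S.0#                            ≈⟨ S.+-cong (Eval.eval-* u f) (S.trans (Eval.eval-* v M)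
                                                         (S.trans (S.*-congˡ {Eval.eval v} (Eval.eval-xⁿ-1 n X^n≈1))
                                                           (S.zeroʳ (Eval.eval v)))) ⟨
        Eval.eval (u ℙ.* f) S.+ Eval.eval (v ℙ.* M)  ≈⟨ Eval.eval-+ (u ℙ.* f) (v ℙ.* M) ⟨
        Eval.eval (u ℙ.* f ℙ.+ v ℙ.* M)             ≈⟨ Eval.eval-cong combination ⟨
        Eval.eval (𝔽₂[X].X ℙ.^ k ℙ.* d)             ≈⟨ Eval.eval-* (𝔽₂[X].X ℙ.^ k) d ⟩
        Eval.eval (𝔽₂[X].X ℙ.^ k) S.* D             ≈⟨ S.*-congʳ {D} (Eval.eval-X^ k) ⟩
        X S.^ k S.* D                               ∎

  ⋆-fixed⇒symmetric : ∀ a → (ι ∘ a) ⋆ S.≈ ι ∘ a → Symmetric n (fromVector a)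
  ⋆-fixed⇒symmetric a fixed i 1≤i i<n = begin
    coeff f i              ≡⟨ cong (coeff f) toℕ-k ⟨
    coeff f (toℕ k)        ≡⟨ coeff-fromVector a k ⟩
    a k                    ≡⟨ ι-injective (fixed k) ⟨
    a (⊖ k)                ≡⟨ coeff-fromVector a (⊖ k) ⟨
    coeff f (toℕ (⊖ k))    ≡⟨ cong (coeff f) (≡.trans (toℕ-⊖ k k≢0) (cong (n ℕ.∸_) toℕ-k)) ⟩
    coeff f (n ℕ.∸ i)      ∎
    where
    open ≡.≡-Reasoning
    open 𝔽₂[X] using (coeff)
    f = fromVector a
    k = fromℕ< i<n
    toℕ-k : toℕ k ≡ i
    toℕ-k = toℕ-fromℕ< i<n
    k≢0 : k ≢ zero
    k≢0 k≡0 = ℕ.<⇒≢ 1≤i (≡.trans (≡.sym (cong toℕ k≡0)) toℕ-k)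

  symmetric⇒⋆-fixed : ∀ a → Symmetric n (fromVector a) → (ι ∘ a) ⋆ S.≈ ι ∘ a
  -- `Symmetric` leaves the constant coefficient free; the involution fixes it anyway.
  symmetric⇒⋆-fixed a symmetric zero    = reflexive (cong (ι ∘ a) ⊖-zero)
  symmetric⇒⋆-fixed a symmetric k@(suc _) = reflexive (cong ι (begin
    a (⊖ k)                ≡⟨ coeff-fromVector a (⊖ k) ⟨
    coeff f (toℕ (⊖ k))    ≡⟨ cong (coeff f) (toℕ-⊖ k λ ()) ⟩
    coeff f (n ℕ.∸ toℕ k)  ≡⟨ symmetric (toℕ k) (ℕ.s≤s ℕ.z≤n) (toℕ<n k) ⟨
    coeff f (toℕ k)        ≡⟨ coeff-fromVector a k ⟩
    a k                    ∎))
    where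
    open ≡.≡-Reasoning
    open 𝔽₂[X] using (coeff)
    f = fromVector a

  characterization : (a : Vector Bool n) →
    (∃ λ α → IsNormal n α × HasCorrespondingVector α a) ⇔
    (Symmetric n (fromVector a) × CoprimeToXⁿ-1 a)
  characterization a = mk⇔ necessary sufficient
    where
    necessary : (∃ λ α → IsNormal n α × HasCorrespondingVector α a) →
      Symmetric n (fromVector a) × CoprimeToXⁿ-1 a
    necessary (α , normal , corresponding) =
      ⋆-fixed⇒symmetric a (S.trans (⋆-cong a≈norm)
        (S.trans (norm-symmetric (orbit α)) (S.sym a≈norm))) ,
      unit⇒coprime a (S.trans (support-cong a≈norm) (norm-unit {orbit α} (normal⇒unit normal)))
      where
      a≈norm : ι ∘ a S.≈ orbit α S.* orbit α ⋆
      a≈norm k = trans (corresponding k) (sym (orbit-norm α k))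

    sufficient : Symmetric n (fromVector a) × CoprimeToXⁿ-1 a →
      ∃ λ α → IsNormal n α × HasCorrespondingVector α a
    sufficient (symmetric , coprime) = fromNorm (symmetric-unit⇒norm {ι ∘ a} (rational-ι a)
        (symmetric⇒⋆-fixed a symmetric) (coprime⇒unit a coprime))
      where
      fromNorm : (∃ λ α → support (orbit α) S.≈ S.1# × (orbit α S.* orbit α ⋆) S.≈ ι ∘ a) →
        ∃ λ α → IsNormal n α × HasCorrespondingVector α a
      fromNorm (α , unit , norm≈a) =
        α , unit⇒normal unit , λ k → trans (sym (norm≈a k)) (orbit-norm α k)

open import Data.Nat.Base using (_^_)

theorem4p2 : ∀ {c ℓ} (n : ℕ) → ¬ (2 ∣ n) →
    (K : CommutativeRing c ℓ) → IsFieldOfOrder K (2 ^ n) →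
    (a : Vector Bool n) →
    (∃ λ α → Extension.IsNormal K n α × Extension.HasCorrespondingVector K α a)
    ⇔
    (𝔽₂[X].Symmetric n (𝔽₂[X].fromVector a) ×
    IsGCD 𝔽₂[X].*-rawMagma (𝔽₂[X].fromVector a) (𝔽₂[X].xⁿ-1 n) 𝔽₂[X].1#)
theorem4p2 zero    odd K isField a = ⊥-elim (odd (divides 0 ≡.refl))
theorem4p2 (suc m) odd K isField a =
  Characterization.characterization K m isField (NormalElements.frobeniusPeriod K m isField odd) a
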